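{- For every positive integer $t$, as power series in $q$, \[ F_t(x;q)=\begin{cases}(-q^2;q^2)_\infty\left((1-x^2)q^{2t};q^{2t}\right)_\infty^{\frac{t-1}{2}}D^*(x;q^t) & \text{if } t \text{ is odd},\\[4pt] (-q^2;q^2)_\infty\left((1-x^2)q^{2t};q^{2t}\right)_\infty^{\frac{t-2}{2}}D^*(x;q^t)\,H^*(x;q^t) & \text{if } t\text{ is even},\end{cases} \] where $F_t(x;q)=\sum_{\lambda\lambda\in\mathcal{DD}}x^{n_t(\lambda\lambda)}q^{|\lambda\lambda|}$ and \[ D^*(x;q)=\frac{1}{1+x}\Big(\left((1-x^2)q^2;q^4\right)_\infty+x\left((1-x^2)q^4;q^4\right)_\infty\Big), \] \[ H^*(x;q)=\frac{1}{2x}\left[\left(1-\sqrt{\tfrac{1-x}{1+x}}\right)\left(-\sqrt{1-x^2};-q\right)_\infty+\left(1+\sqrt{\tfrac{1-x}{1+x}}\right)\left(\sqrt{1-x^2};-q\right)_\infty\right]. \]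
   Context: Notation: $(a;q)_\infty=\prod_{k\ge1}(1-aq^{k-1})$. The two square roots in $H^*$ are chosen compatibly, i.e. $\sqrt{1-x^2}=(1+x)\sqrt{(1-x)/(1+x)}$ (e.g. both nonnegative for $0<x<1$); $H^*$ does not depend on this choice. A partition is a finite weakly decreasing sequence of positive integers (the empty partition included); $|\lambda|$ is the sum of its parts. The box $(i,j)$ is the box in row $i$, column $j$ of the Young diagram. The hook of a box consists of the box itself and all boxes to its right in the same row or below it in the same column; the hook length is the number of boxes in the hook; a $t$-hook is a hook of length $t$. $n_t(\lambda)$ denotes the number of $t$-hooks of $\lambda$. A strict partition is a partition into distinct parts. For a strict partition $\lambda=(\lambda_1>\dots>\lambda_\ell)$, the doubled distinct partition $\lambda\lambda$ is obtained from the shifted Young diagram of $\lambda$ (row $i$ moved right by $i-1$ boxes) by adding $\lambda_i$ boxes to the $(i-1)$-st column for each $i$; equivalently, $\lambda\lambda$ is the partition of $2|\lambda|$ with Frobenius symbol $\begin{pmatrix}\lambda_1&\cdots&\lambda_\ell\\ \lambda_1-1&\cdots&\lambda_\ell-1\end{pmatrix}$ (the Frobenius symbol of $\mu$ with Durfee square of side $s$ has top row $\mu_i-i$ and bottom row $\mu'_i-i$, $1\le i\le s$, where $\mu'$ is the conjugate partition). E.g. $\lambda=(5,4,1)$ gives $\lambda\lambda=(6,6,4,2,2)$. $\mathcal{DD}$ is the set of all doubled distinct partitions (including the empty one). -}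

module Defs where

open import Algebra.Bundles using (CommutativeRing; RawRing; Semiring)
open import Data.Bool.Base using (true; false)
open import Data.Empty using (⊥-elim)
open import Data.Fin.Base as Fin using (Fin; toℕ)
open import Data.Fin.Properties using (toℕ<n)
open import Data.List.Base
  using (List; []; _∷_; _++_; map; filter; foldr; length; applyUpTo; upTo)
open import Data.List.Membership.Propositional using (_∈_)
open import Data.List.Membership.Propositional.Properties
  using (∈-map⁺; ∈-map⁻; ∈-filter⁺; ∈-filter⁻; ∈-++⁺ˡ; ∈-++⁺ʳ; ∈-++⁻)
open import Data.List.Properties using (length-applyUpTo; filter-reject; map-applyUpTo)
open import Data.List.Relation.Unary.All as All using (All; []; _∷_)
open import Data.List.Relation.Unary.AllPairs using ([]; _∷_)
open import Data.List.Relation.Unary.Any using (here)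
open import Data.List.Relation.Unary.Linked using (Linked; []; [-]; _∷_)
open import Data.List.Relation.Unary.Linked.Properties using (Linked⇒AllPairs)
open import Data.List.Relation.Unary.Unique.Propositional using (Unique)
import Data.List.Relation.Unary.Unique.Propositional.Properties as Uniq
open import Data.Nat.ListAction using () renaming (sum to size)
open import Data.Nat.Base using (ℕ; zero; suc; z≤n; s≤s; _∸_; _≤_; _<_; _>_)
import Data.Nat.Base as ℕ
import Data.Nat.Properties as ℕ
open import Data.Nat.Properties using (_≟_; _≤?_; _<?_)
open import Data.Product.Base using (∃; _×_; _,_; proj₁; proj₂)
open import Data.Sum.Base using (inj₁; inj₂)
open import Function.Base using (_∘_)
open import Function.Bundles using (_⇔_; mk⇔)
open import Relation.Binary.PropositionalEquality
  using (_≡_; _≢_; refl; sym; trans; cong; subst)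
open import Relation.Nullary using (¬_; yes; no)
open import Relation.Nullary.Decidable using (_×-dec_)
open import Relation.Unary using (Pred; Decidable)

-- A partition is the list of its parts, largest first.

StrictPartition : List ℕ → Set
StrictPartition ν = Linked _>_ ν × All (0 <_) ν

count : ∀ {p} {P : Pred ℕ p} → Decidable P → List ℕ → ℕ
count P? xs = length (filter P? xs)

part : List ℕ → ℕ → ℕ
part []      _       = 0
part (a ∷ ν) zero    = a
part (a ∷ ν) (suc i) = part ν i

-- Rows are numbered from 0, and column 0 is the column to the left of the
-- shifted diagram of ν (so row i of the shifted diagram starts in column
-- i + 1).  Column i of that diagram has i boxes, in rows 0, …, i - 1; the
-- part i ν boxes added to it therefore lie in rows i, …, i + part ν i - 1.
-- The lowest row reached in this way is row (part ν 0 - 1).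

doubledRow : List ℕ → ℕ → ℕ
doubledRow ν r =
  part ν r ℕ.+ count (λ i → (i ≤? r) ×-dec (r <? i ℕ.+ part ν i)) (upTo (length ν))

doubled : List ℕ → List ℕ
doubled ν = applyUpTo (doubledRow ν) (part ν 0)

_ : doubled (5 ∷ 4 ∷ 1 ∷ []) ≡ 6 ∷ 6 ∷ 4 ∷ 2 ∷ 2 ∷ []
_ = refl

DoubledDistinct : List ℕ → Set
DoubledDistinct μ = ∃ λ ν → StrictPartition ν × μ ≡ doubled ν

-- In the row of length m lying above the rows μ, the box in column j
-- (numbered from 0) has m - 1 - j boxes to its right, and the boxes below it
-- lie in the rows of μ of length > j.

hookLengths : List ℕ → List ℕ
hookLengths []      = []
hookLengths (m ∷ μ) =
  map (λ j → 1 ℕ.+ (m ∸ suc j) ℕ.+ count (j <?_) μ) (upTo m) ++ hookLengths μ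

hookCount : ℕ → List ℕ → ℕ
hookCount t μ = count (_≟ t) (hookLengths μ)

strictPartitions≤ : ℕ → List (List ℕ)
strictPartitions≤ zero    = [] ∷ []
strictPartitions≤ (suc m) =
  strictPartitions≤ m ++ map (suc m ∷_) (strictPartitions≤ m)

-- Parts of ν larger than n are irrelevant here, as doubled ν has first part
-- 1 + part ν 0.  See ∈-doubledDistincts and doubledDistincts-unique.

doubledDistincts : ℕ → List (List ℕ)
doubledDistincts n = filter (λ μ → size μ ≟ n) (map doubled (strictPartitions≤ n))

strict-tail : ∀ {a ν} → StrictPartition (a ∷ ν) → StrictPartition ν
strict-tail ([-]    , _ ∷ ps) = [] , ps
strict-tail (_ ∷ ls , _ ∷ ps) = ls , ps

strict-below : ∀ {a ν} → StrictPartition (a ∷ ν) → All (_< a) ν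
strict-below (ls , _) with Linked⇒AllPairs (λ p q → ℕ.<-trans q p) ls
... | as ∷ _ = as

strict-cons : ∀ {a ν} → 0 < a → All (_< a) ν → StrictPartition ν → StrictPartition (a ∷ ν)
strict-cons {ν = []}    p _       _         = [-] , p ∷ []
strict-cons {ν = _ ∷ _} p (q ∷ _) (ls , ps) = q ∷ ls , p ∷ ps

strict≤-sound : ∀ m {ν} → ν ∈ strictPartitions≤ m → StrictPartition ν × All (_≤ m) ν
strict≤-sound zero (here refl) = ([] , []) , []
strict≤-sound (suc m) ν∈ with ∈-++⁻ (strictPartitions≤ m) ν∈
... | inj₁ h = let s , b = strict≤-sound m h in s , All.map ℕ.m≤n⇒m≤1+n b
... | inj₂ h with ∈-map⁻ (suc m ∷_) h
...   | _ , h′ , refl =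
        let s , b = strict≤-sound m h′ in
        strict-cons (s≤s z≤n) (All.map s≤s b) s , ℕ.≤-refl ∷ All.map ℕ.m≤n⇒m≤1+n b

strict≤-complete : ∀ m {ν} → StrictPartition ν → All (_≤ m) ν → ν ∈ strictPartitions≤ m
strict≤-complete zero {[]} _ _ = here refl
strict≤-complete zero {_ ∷ _} (_ , p ∷ _) (q ∷ _) = ⊥-elim (ℕ.<⇒≱ p q)
strict≤-complete (suc m) {[]} s _ = ∈-++⁺ˡ (strict≤-complete m s [])
strict≤-complete (suc m) {a ∷ ν} s (q ∷ qs) with a ≟ suc m
... | yes refl = ∈-++⁺ʳ (strictPartitions≤ m) (∈-map⁺ (suc m ∷_)
                   (strict≤-complete m (strict-tail s) (All.map ℕ.≤-pred (strict-below s))))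
... | no a≢ = ∈-++⁺ˡ (strict≤-complete m s (a≤m ∷ All.map (λ b<a → ℕ.≤-trans (ℕ.<⇒≤ b<a) a≤m) (strict-below s)))
  where a≤m = ℕ.≤-pred (ℕ.≤∧≢⇒< q a≢)

strict≤-unique : ∀ m → Unique (strictPartitions≤ m)
strict≤-unique zero    = [] ∷ []
strict≤-unique (suc m) = Uniq.++⁺ ih (Uniq.map⁺ (λ { refl → refl }) ih) disjoint
  where
  ih = strict≤-unique m
  disjoint : ∀ {ν} → ν ∈ strictPartitions≤ m × ν ∈ map (suc m ∷_) (strictPartitions≤ m) → _
  disjoint (p , q) with ∈-map⁻ (suc m ∷_) q
  ... | _ , _ , refl with strict≤-sound m p
  ...   | _ , b ∷ _ = ℕ.<⇒≱ ℕ.≤-refl b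

count-map-suc : ∀ {p q} {P : Pred ℕ p} {Q : Pred ℕ q} (P? : Decidable P) (Q? : Decidable Q) →
                (∀ i → P (suc i) → Q i) → (∀ i → Q i → P (suc i)) →
                ∀ xs → count P? (map suc xs) ≡ count Q? xs
count-map-suc P? Q? f g [] = refl
count-map-suc P? Q? f g (x ∷ xs) with P? (suc x) | Q? x
... | yes _ | yes _ = cong suc (count-map-suc P? Q? f g xs)
... | no _  | no _  = count-map-suc P? Q? f g xs
... | yes p | no ¬q = ⊥-elim (¬q (f x p))
... | no ¬p | yes q = ⊥-elim (¬p (g x q))

count-none : ∀ {p} {P : Pred ℕ p} (P? : Decidable P) → (∀ i → ¬ P (suc i)) →
             ∀ xs → count P? (map suc xs) ≡ 0
count-none P? f [] = refl
count-none P? f (x ∷ xs) with P? (suc x)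
... | yes p = ⊥-elim (f x p)
... | no _  = count-none P? f xs

doubledRow-zero : ∀ a ν → 0 < a → doubledRow (a ∷ ν) 0 ≡ suc a
doubledRow-zero (suc a) ν _ =
  trans (cong (λ xs → suc a ℕ.+ suc (count row? xs)) (sym (map-applyUpTo (λ i → i) suc (length ν))))
  (trans (cong (λ k → suc a ℕ.+ suc k) (count-none row? (λ { _ (() , _) }) (upTo (length ν))))
  (ℕ.+-comm (suc a) 1))
  where
  row? : Decidable (λ i → i ≤ 0 × 0 < i ℕ.+ part (suc a ∷ ν) i)
  row? i = (i ≤? 0) ×-dec (0 <? i ℕ.+ part (suc a ∷ ν) i)

doubledRow-suc : ∀ a ν r →
  doubledRow (a ∷ ν) (suc r) ≡ count (suc r <?_) (a ∷ []) ℕ.+ doubledRow ν r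
doubledRow-suc a ν r
  rewrite sym (map-applyUpTo (λ i → i) suc (length ν)) with suc r ℕ.<ᵇ a
... | true = trans (cong (λ k → part ν r ℕ.+ suc k) step) (ℕ.+-suc (part ν r) _)
  where
  step = count-map-suc (λ i → (i ≤? suc r) ×-dec (suc r <? i ℕ.+ part (a ∷ ν) i))
           (λ i → (i ≤? r) ×-dec (r <? i ℕ.+ part ν i))
           (λ { i (s≤s p , s≤s q) → p , q }) (λ { i (p , q) → s≤s p , s≤s q }) (upTo (length ν))
... | false = cong (part ν r ℕ.+_) step
  where
  step = count-map-suc (λ i → (i ≤? suc r) ×-dec (suc r <? i ℕ.+ part (a ∷ ν) i))
           (λ i → (i ≤? r) ×-dec (r <? i ℕ.+ part ν i))
           (λ { i (s≤s p , s≤s q) → p , q }) (λ { i (p , q) → s≤s p , s≤s q }) (upTo (length ν))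

part-applyUpTo : ∀ f n r → r < n → part (applyUpTo f n) r ≡ f r
part-applyUpTo f (suc n) zero    _       = refl
part-applyUpTo f (suc n) (suc r) (s≤s p) = part-applyUpTo (f ∘ suc) n r p

doubledRow-beyond : ∀ {ν} → StrictPartition ν → ∀ r → All (_≤ r) ν → doubledRow ν r ≡ 0
doubledRow-beyond {[]} _ r _ = refl
doubledRow-beyond {a ∷ ν} (_ , p ∷ _) zero (q ∷ _) = ⊥-elim (ℕ.<⇒≱ p q)
doubledRow-beyond {a ∷ ν} s (suc r) (q ∷ _) =
  trans (doubledRow-suc a ν r)
    (trans (cong (ℕ._+ doubledRow ν r)
             (cong length (filter-reject (suc r <?_) {xs = []} (ℕ.≤⇒≯ q))))
      (doubledRow-beyond (strict-tail s) r
        (All.map (λ b<a → ℕ.≤-pred (ℕ.≤-trans b<a q)) (strict-below s))))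

doubledRow-injective : ∀ {ν ν′} → StrictPartition ν → StrictPartition ν′ →
                       (∀ r → doubledRow ν r ≡ doubledRow ν′ r) → ν ≡ ν′
doubledRow-injective {[]} {[]} _ _ _ = refl
doubledRow-injective {[]} {b ∷ ν′} _ (_ , q ∷ _) e with trans (e 0) (doubledRow-zero b ν′ q)
... | ()
doubledRow-injective {a ∷ ν} {[]} (_ , p ∷ _) _ e with trans (sym (e 0)) (doubledRow-zero a ν p)
... | ()
doubledRow-injective {a ∷ ν} {b ∷ ν′} s@(_ , p ∷ _) s′@(_ , q ∷ _) e
  with ℕ.suc-injective (trans (sym (doubledRow-zero a ν p)) (trans (e 0) (doubledRow-zero b ν′ q)))
... | refl = cong (a ∷_) (doubledRow-injective (strict-tail s) (strict-tail s′) λ r →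
               ℕ.+-cancelˡ-≡ (count (suc r <?_) (a ∷ [])) _ _
                 (trans (sym (doubledRow-suc a ν r)) (trans (e (suc r)) (doubledRow-suc a ν′ r))))

parts≤head : ∀ {ν} → StrictPartition ν → All (_≤ part ν 0) ν
parts≤head {[]}    _ = []
parts≤head {a ∷ ν} s = ℕ.≤-refl ∷ All.map ℕ.<⇒≤ (strict-below s)

doubled-injective : ∀ {ν ν′} → StrictPartition ν → StrictPartition ν′ →
                    doubled ν ≡ doubled ν′ → ν ≡ ν′
doubled-injective {ν} {ν′} s s′ e = doubledRow-injective s s′ rows
  where
  heads : part ν 0 ≡ part ν′ 0
  heads = trans (sym (length-applyUpTo (doubledRow ν) _))
            (trans (cong length e) (length-applyUpTo (doubledRow ν′) _))
  rows : ∀ r → doubledRow ν r ≡ doubledRow ν′ r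
  rows r with r <? part ν 0
  ... | yes p = trans (sym (part-applyUpTo (doubledRow ν) _ r p))
                  (trans (cong (λ μ → part μ r) e)
                    (part-applyUpTo (doubledRow ν′) _ r (subst (r <_) heads p)))
  ... | no ¬p = trans (doubledRow-beyond s r (bound s (ℕ.≮⇒≥ ¬p)))
                  (sym (doubledRow-beyond s′ r (bound s′ (subst (_≤ r) heads (ℕ.≮⇒≥ ¬p)))))
    where
    bound : ∀ {ξ} → StrictPartition ξ → part ξ 0 ≤ r → All (_≤ r) ξ
    bound s q = All.map (λ b≤ → ℕ.≤-trans b≤ q) (parts≤head s)

parts≤size : ∀ {ν n} → StrictPartition ν → size (doubled ν) ≡ n → All (_≤ n) ν
parts≤size {[]} _ _ = []
parts≤size {suc a ∷ ν} {n} s e = All.map (λ b≤ → ℕ.≤-trans b≤ bound) (parts≤head s)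
  where
  bound : suc a ≤ n
  bound = ℕ.≤-trans (ℕ.n≤1+n (suc a))
            (subst (λ k → suc (suc a) ≤ k) e
              (subst (λ k → k ≤ size (doubled (suc a ∷ ν))) (doubledRow-zero (suc a) ν (s≤s z≤n))
                (ℕ.m≤m+n (doubledRow (suc a ∷ ν) 0) _)))
parts≤size {zero ∷ _} (_ , () ∷ _) _

map-unique : ∀ {νs} → All StrictPartition νs → Unique νs → Unique (map doubled νs)
map-unique [] [] = []
map-unique {ν ∷ νs} (s ∷ ss) (ν≢ ∷ u) = apart ss ν≢ ∷ map-unique ss u
  where
  apart : ∀ {ξs} → All StrictPartition ξs → All (ν ≢_) ξs → All (doubled ν ≢_) (map doubled ξs)
  apart []       []       = []
  apart (s′ ∷ r) (n ∷ ns) = (n ∘ doubled-injective s s′) ∷ apart r ns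

∈-doubledDistincts : ∀ {μ n} → μ ∈ doubledDistincts n ⇔ (DoubledDistinct μ × size μ ≡ n)
∈-doubledDistincts {μ} {n} = mk⇔ to from
  where
  to : μ ∈ doubledDistincts n → DoubledDistinct μ × size μ ≡ n
  to h with ∈-filter⁻ (λ μ → size μ ≟ n) {xs = map doubled (strictPartitions≤ n)} h
  ... | h′ , e with ∈-map⁻ doubled h′
  ...   | ν , ν∈ , μ≡ = (ν , proj₁ (strict≤-sound n ν∈) , μ≡) , e
  from : DoubledDistinct μ × size μ ≡ n → μ ∈ doubledDistincts n
  from ((ν , s , refl) , e) = ∈-filter⁺ (λ μ → size μ ≟ n)
    (∈-map⁺ doubled (strict≤-complete n s (parts≤size s e))) e

doubledDistincts-unique : ∀ n → Unique (doubledDistincts n)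
doubledDistincts-unique n = Uniq.filter⁺ (λ μ → size μ ≟ n)
  (map-unique (All.tabulate (proj₁ ∘ strict≤-sound n)) (strict≤-unique n))

module PowerSeries {c ℓ} (R : CommutativeRing c ℓ) where
  open CommutativeRing R renaming (refl to ≈-refl; sym to ≈-sym; trans to ≈-trans)
  open import Algebra.Definitions.RawSemiring (Semiring.rawSemiring semiring) public using (_^_)
  open import Algebra.Definitions.RawSemiring (Semiring.rawSemiring semiring) using (sum)

  Series : Set c
  Series = ℕ → Carrier

  infix  8 ⊖_
  infixl 7 _⊛_
  infixl 6 _⊕_
  infix  4 _≋_

  _≋_ : Series → Series → Set ℓ
  f ≋ g = ∀ n → f n ≈ g n

  _⊕_ : Series → Series → Series
  (f ⊕ g) n = f n + g n

  ⊖_ : Series → Series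
  (⊖ f) n = - f n

  _⊛_ : Series → Series → Series
  (f ⊛ g) n = sum {suc n} (λ i → f (toℕ i) * g (n ∸ toℕ i))

  const : Carrier → Series
  const a zero    = a
  const a (suc _) = 0#

  q : Series
  q 1 = 1#
  q _ = 0#

  seriesRing : RawRing c ℓ
  seriesRing = record
    { Carrier = Series ; _≈_ = _≋_ ; _+_ = _⊕_ ; _*_ = _⊛_ ; -_ = ⊖_
    ; 0# = const 0# ; 1# = const 1# }

  open import Algebra.Definitions.RawSemiring (RawRing.rawSemiring seriesRing) public
    using () renaming (_^_ to _↑_)

  finitePochhammer : Series → Series → ℕ → Series
  finitePochhammer A Q zero    = const 1#
  finitePochhammer A Q (suc k) = (const 1# ⊕ ⊖ (A ⊛ Q ↑ k)) ⊛ finitePochhammer A Q k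

  -- The infinite product ∏_{k ≥ 0} (1 - A Q^k), for Q with zero constant
  -- term: the factors with k > n are 1 modulo q^{n+1}, so the coefficient of
  -- q^n is that of the product over k ≤ n (see pochhammer-limit).

  ⟦_⨾_⟧∞ : Series → Series → Series
  ⟦ A ⨾ Q ⟧∞ n = finitePochhammer A Q (suc n) n

  sum-zero : ∀ n (f : Fin n → Carrier) → (∀ i → f i ≈ 0#) → sum f ≈ 0#
  sum-zero zero    f z = ≈-refl
  sum-zero (suc n) f z =
    ≈-trans (+-cong (z Fin.zero) (sum-zero n (f ∘ Fin.suc) (z ∘ Fin.suc))) (+-identityˡ 0#)

  ↑-vanish : ∀ Q → Q 0 ≈ 0# → ∀ k j → j < k → (Q ↑ k) j ≈ 0#
  ↑-vanish Q Q₀ (suc k) j (s≤s j≤k) = sum-zero (suc j) (λ i → Q (toℕ i) * (Q ↑ k) (j ∸ toℕ i)) λ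
    { Fin.zero    → ≈-trans (*-congʳ Q₀) (zeroˡ _)
    ; (Fin.suc i) → ≈-trans (*-congˡ (↑-vanish Q Q₀ k (j ∸ suc (toℕ i)) (below i))) (zeroʳ _) }
    where
    below : (i : Fin j) → j ∸ suc (toℕ i) < k
    below i = ℕ.<-≤-trans (ℕ.∸-monoʳ-< {j} {suc (toℕ i)} {0} (s≤s z≤n) (toℕ<n i)) j≤k

  factor-vanish : ∀ A Q → Q 0 ≈ 0# → ∀ k j → j < k → (A ⊛ Q ↑ k) j ≈ 0#
  factor-vanish A Q Q₀ k j j<k = sum-zero (suc j) (λ i → A (toℕ i) * (Q ↑ k) (j ∸ toℕ i)) λ i →
    ≈-trans (*-congˡ (↑-vanish Q Q₀ k (j ∸ toℕ i) (ℕ.≤-<-trans (ℕ.m∸n≤m j (toℕ i)) j<k))) (zeroʳ _)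

  -0≈0 : ∀ {a} → a ≈ 0# → - a ≈ 0#
  -0≈0 {a} z = ≈-trans (≈-sym (+-identityˡ (- a))) (≈-trans (+-congʳ (≈-sym z)) (-‿inverseʳ a))

  factor-absorb : ∀ A Q → Q 0 ≈ 0# → ∀ k n → n < k → ∀ P →
                  ((const 1# ⊕ ⊖ (A ⊛ Q ↑ k)) ⊛ P) n ≈ P n
  factor-absorb A Q Q₀ k n n<k P = ≈-trans
    (+-cong
      (≈-trans (*-congʳ (≈-trans (+-congˡ (-0≈0 (factor-vanish A Q Q₀ k 0 (ℕ.≤-<-trans z≤n n<k))))
                             (+-identityʳ 1#)))
             (*-identityˡ (P n)))
      (sum-zero n _ λ i → ≈-trans
        (*-congʳ (≈-trans (+-identityˡ _)
          (-0≈0 (factor-vanish A Q Q₀ k (suc (toℕ i)) (ℕ.≤-<-trans (toℕ<n i) n<k)))))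
        (zeroˡ _)))
    (+-identityʳ (P n))

  pochhammer-limit : ∀ A Q → Q 0 ≈ 0# → ∀ n d →
                     finitePochhammer A Q (d ℕ.+ suc n) n ≈ ⟦ A ⨾ Q ⟧∞ n
  pochhammer-limit A Q Q₀ n zero    = ≈-refl
  pochhammer-limit A Q Q₀ n (suc d) = ≈-trans
    (factor-absorb A Q Q₀ (d ℕ.+ suc n) n (ℕ.m≤n+m (suc n) d) (finitePochhammer A Q (d ℕ.+ suc n)))
    (pochhammer-limit A Q Q₀ n d)

  F : ℕ → Carrier → Series
  F t x n = foldr _+_ 0# (map (λ μ → x ^ hookCount t μ) (doubledDistincts n))

  -- D* x [1+x]⁻¹ Q is D*(x; Q), where [1+x]⁻¹ is the inverse of 1 + x.

  D* : (x [1+x]⁻¹ : Carrier) → Series → Series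
  D* x [1+x]⁻¹ Q =
    const [1+x]⁻¹ ⊛
      ( ⟦ const (1# - x ^ 2) ⊛ Q ↑ 2 ⨾ Q ↑ 4 ⟧∞
      ⊕ const x ⊛ ⟦ const (1# - x ^ 2) ⊛ Q ↑ 4 ⨾ Q ↑ 4 ⟧∞ )

  -- H* [2x]⁻¹ s r Q is H*(x; Q), where [2x]⁻¹ is the inverse of 2x,
  -- s = √((1-x)/(1+x)) and r = √(1-x²).

  H* : ([2x]⁻¹ s r : Carrier) → Series → Series
  H* [2x]⁻¹ s r Q =
    const [2x]⁻¹ ⊛
      ( const (1# - s) ⊛ ⟦ const (- r) ⨾ ⊖ Q ⟧∞
      ⊕ const (1# + s) ⊛ ⟦ const r ⨾ ⊖ Q ⟧∞ )

{-# OPTIONS --safe #-}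

-- Let ε_a say whether a is a part of the strict partition λ.  In the boundary
-- path of λλ the places a and -a carry ε_a and 1 - ε_a and place 0 carries 0,
-- and a t-hook is a 1 lying t places above a 0.  Hence adding a largest part a
-- creates a number of t-hooks that depends on at most one other bit: on
-- ε_{a-t} if a > t and on ε_{t-a} if t/2 < a < t.  So the sum over λ is a sum
-- over a forest, and summing out the bits from the largest downwards factors
-- it into contributions of the residues 0, t/2 and ±c mod t.
--
-- Each contribution is built from the generating functions A(z,w) and B(z,w)
-- of 0/1 sequences, where w = 1 - x² and Q = q^{2t}.  The relations
--   A(z,wQ) = B(z,w),   z(1 - wQ) B(zQ,wQ) = A(zQ,w) - (1 - z) B(zQ,w)
-- give first order equations in w (in √w for the residue t/2), so that each
-- contribution is its value at w = 0 times a Pochhammer product or a sum of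
-- two.  The values at w = 0 need not be computed: by the same factorization at
-- x = 1 they multiply to (-q²;q²)_∞.

module Submission where

open import Defs
open import Algebra.Bundles using (CommutativeRing)
import Algebra.Solver.Ring
open import Algebra.Solver.Ring.AlmostCommutativeRing
  using (fromCommutativeRing; _-Raw-AlmostCommutative⟶_)
open import Data.Bool.Base using (Bool; true; false; not; if_then_else_)
open import Data.Empty using (⊥-elim)
open import Data.Integer.Base as ℤ using (ℤ)
import Data.Integer.Properties as ℤ
open import Data.List.Base
  using (List; []; _∷_; _++_; _∷ʳ_; map; filter; foldr; length; applyUpTo; upTo)
open import Data.List.Properties
  using (applyUpTo-∷ʳ; map-applyUpTo; map-upTo; length-++; length-map; map-++; map-∘; filter-++;
         filter-none; filter-accept)
open import Data.List.Relation.Unary.All as All using (All; []; _∷_)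
open import Data.List.Relation.Unary.Linked using ([])
open import Data.Maybe.Base using (Maybe; just; nothing)
open import Data.Nat as ℕ using (ℕ; zero; suc; _∸_; _/_; _≤_; _<_; z≤n; s≤s; NonZero)
open import Data.Nat.Divisibility using (_∣_; divides; ∣m+n∣m⇒∣n; ∣1⇒≡1)
open import Data.Nat.DivMod using (m*n/n≡m)
open import Data.Nat.ListAction using (sum)
open import Data.Nat.ListAction.Properties using (sum-++)
import Data.Nat.Properties as ℕ
open import Data.Nat.Properties using (_≟_; _≤?_; _<?_)
import Data.Nat.Tactic.RingSolver as ℕ-Solver
open import Data.Product using (_×_; _,_; ∃)
open import Data.Sum.Base using (_⊎_; inj₁; inj₂)
open import Data.Vec.Base using (Vec; []; _∷_)
open import Function.Base using (_∘_)
open import Relation.Binary.PropositionalEquality as ≡ using (_≡_; _≢_)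
open import Relation.Nullary using (¬_; does; yes; no)
open import Relation.Nullary.Decidable using (dec-true; dec-false)
open import Relation.Unary using (Pred; Decidable)

-- The runners and the products are infinite, but no limit is ever taken. Coefficient n is computed
-- modulo q^(n+1), where u = q² is nilpotent: a runner then has finitely many places of nonzero
-- weight, iterating w ↦ wQ reaches w = 0 exactly, and every infinite product is a finite one.
--
-- Places a and -a of the boundary path carry complementary entries, so hooks arise in twos and
-- weigh x² = 1 - w. The exceptions are a part t, which meets place 0, and a part t/2, which meets
-- its own mirror image: each creates a single hook. Hence the residues ±c see only w and yield
-- plain Pochhammer products, while x itself enters at the residues 0 and t/2 and produces D* and
-- H*.
--
-- The generating functions take w as a variable independent of x, because the shift w ↦ wQ destroys
-- the relation w = 1 - x². That relation is used only at the value of w actually wanted, to express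
-- a runner with a weight x at its start through solutions of shift equations.

module IntegerSolver {c ℓ} (S : CommutativeRing c ℓ) where
  open CommutativeRing S
  open import Algebra.Properties.Ring ring
  open import Algebra.Properties.AbelianGroup +-abelianGroup using (⁻¹-∙-comm)
  open import Algebra.Properties.Semiring.Mult.TCOptimised semiring
    using (1+×; ×-homo-+; ×1-homo-*) renaming (_×_ to _⋆_)
  open import Relation.Binary.Reasoning.Setoid setoid

  private
    ι : ℕ → Carrier
    ι n = n ⋆ 1#

    ⟦_⟧ : ℤ → Carrier
    ⟦ ℤ.+ n ⟧      = ι n
    ⟦ ℤ.-[1+ n ] ⟧ = - ι (suc n)

    cancel-1 : ∀ a b → (1# + a) + - (1# + b) ≈ a + - b
    cancel-1 a b = begin
      (1# + a) + - (1# + b)      ≈⟨ +-cong (+-comm 1# a) (sym (⁻¹-∙-comm 1# b)) ⟩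
      (a + 1#) + (- 1# + - b)    ≈⟨ +-assoc a 1# _ ⟩
      a + (1# + (- 1# + - b))    ≈⟨ +-congˡ (sym (+-assoc 1# (- 1#) (- b))) ⟩
      a + ((1# + - 1#) + - b)    ≈⟨ +-congˡ (trans (+-congʳ (-‿inverseʳ 1#)) (+-identityˡ _)) ⟩
      a + - b                    ∎

    ⟦⊖⟧ : ∀ m n → ⟦ m ℤ.⊖ n ⟧ ≈ ι m + - ι n
    ⟦⊖⟧ zero    zero    = sym (-‿inverseʳ 0#)
    ⟦⊖⟧ zero    (suc n) = sym (+-identityˡ _)
    ⟦⊖⟧ (suc m) zero    = sym (trans (+-congˡ -0#≈0#) (+-identityʳ _))
    ⟦⊖⟧ (suc m) (suc n) = begin
      ⟦ suc m ℤ.⊖ suc n ⟧       ≡⟨ ≡.cong ⟦_⟧ (ℤ.[1+m]⊖[1+n]≡m⊖n m n) ⟩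
      ⟦ m ℤ.⊖ n ⟧               ≈⟨ ⟦⊖⟧ m n ⟩
      ι m + - ι n               ≈⟨ cancel-1 (ι m) (ι n) ⟨
      (1# + ι m) + - (1# + ι n) ≈⟨ +-cong (1+× m 1#) (-‿cong (1+× n 1#)) ⟨
      ι (suc m) + - ι (suc n)   ∎

    ⟦+⟧ : ∀ i j → ⟦ i ℤ.+ j ⟧ ≈ ⟦ i ⟧ + ⟦ j ⟧
    ⟦+⟧ (ℤ.+ m)      (ℤ.+ n)      = ×-homo-+ 1# m n
    ⟦+⟧ (ℤ.+ m)      ℤ.-[1+ n ]   = ⟦⊖⟧ m (suc n)
    ⟦+⟧ ℤ.-[1+ m ]   (ℤ.+ n)      = trans (⟦⊖⟧ n (suc m)) (+-comm _ _)
    ⟦+⟧ ℤ.-[1+ m ]   ℤ.-[1+ n ]   = begin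
      - ι (suc (suc (m ℕ.+ n)))      ≡⟨ ≡.cong (λ k → - ι (suc k)) (≡.sym (ℕ.+-suc m n)) ⟩
      - ι (suc m ℕ.+ suc n)          ≈⟨ -‿cong (×-homo-+ 1# (suc m) (suc n)) ⟩
      - (ι (suc m) + ι (suc n))      ≈⟨ ⁻¹-∙-comm _ _ ⟨
      - ι (suc m) + - ι (suc n)      ∎

    ⟦-⟧ : ∀ i → ⟦ ℤ.- i ⟧ ≈ - ⟦ i ⟧
    ⟦-⟧ (ℤ.+ zero)  = sym -0#≈0#
    ⟦-⟧ (ℤ.+ suc n) = refl
    ⟦-⟧ ℤ.-[1+ n ]  = sym (-‿involutive _)

    ⟦*⟧⁺ : ∀ m j → ⟦ ℤ.+ m ℤ.* j ⟧ ≈ ι m * ⟦ j ⟧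
    ⟦*⟧⁺ m (ℤ.+ n) = begin
      ⟦ ℤ.+ m ℤ.* ℤ.+ n ⟧   ≡⟨ ≡.cong ⟦_⟧ (ℤ.pos-* m n) ⟨
      ι (m ℕ.* n)           ≈⟨ ×1-homo-* m n ⟩
      ι m * ι n             ∎
    ⟦*⟧⁺ m ℤ.-[1+ n ] = begin
      ⟦ ℤ.+ m ℤ.* (ℤ.- ℤ.+ suc n) ⟧   ≡⟨ ≡.cong ⟦_⟧ (ℤ.neg-distribʳ-* (ℤ.+ m) (ℤ.+ suc n)) ⟨
      ⟦ ℤ.- (ℤ.+ m ℤ.* ℤ.+ suc n) ⟧   ≈⟨ ⟦-⟧ (ℤ.+ m ℤ.* ℤ.+ suc n) ⟩
      - ⟦ ℤ.+ m ℤ.* ℤ.+ suc n ⟧       ≈⟨ -‿cong (⟦*⟧⁺ m (ℤ.+ suc n)) ⟩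
      - (ι m * ι (suc n))             ≈⟨ -‿distribʳ-* _ _ ⟩
      ι m * - ι (suc n)               ∎

    ⟦*⟧ : ∀ i j → ⟦ i ℤ.* j ⟧ ≈ ⟦ i ⟧ * ⟦ j ⟧
    ⟦*⟧ (ℤ.+ m)    j = ⟦*⟧⁺ m j
    ⟦*⟧ ℤ.-[1+ m ] j = begin
      ⟦ (ℤ.- ℤ.+ suc m) ℤ.* j ⟧    ≡⟨ ≡.cong ⟦_⟧ (ℤ.neg-distribˡ-* (ℤ.+ suc m) j) ⟨
      ⟦ ℤ.- (ℤ.+ suc m ℤ.* j) ⟧    ≈⟨ ⟦-⟧ (ℤ.+ suc m ℤ.* j) ⟩
      - ⟦ ℤ.+ suc m ℤ.* j ⟧        ≈⟨ -‿cong (⟦*⟧⁺ (suc m) j) ⟩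
      - (ι (suc m) * ⟦ j ⟧)        ≈⟨ -‿distribˡ-* _ _ ⟩
      - ι (suc m) * ⟦ j ⟧          ∎

    -- Equality in the ring need not be decidable. Integer coefficients have decidable equality, so
    -- like terms can be collected and cancelled.
    morphism : ℤ.+-*-rawRing -Raw-AlmostCommutative⟶ fromCommutativeRing S
    morphism = record
      { ⟦_⟧ = ⟦_⟧ ; +-homo = ⟦+⟧ ; *-homo = ⟦*⟧ ; -‿homo = ⟦-⟧
      ; 0-homo = refl ; 1-homo = refl }

    ⟦⟧-≟ : ∀ i j → Maybe (⟦ i ⟧ ≈ ⟦ j ⟧)
    ⟦⟧-≟ i j with i ℤ.≟ j
    ... | yes i≡j = just (reflexive (≡.cong ⟦_⟧ i≡j))
    ... | no _    = nothing

  open Algebra.Solver.Ring ℤ.+-*-rawRing (fromCommutativeRing S) morphism ⟦⟧-≟ public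
    using (solve; Polynomial; con; _:=_; _:+_; _:*_; _:-_; :-_)

  :0 :1 : ∀ {n} → Polynomial n
  :0 = con (ℤ.+ 0)
  :1 = con (ℤ.+ 1)

-- Pochhammer products and first order equations

module Pochhammer {c ℓ} (S : CommutativeRing c ℓ) where
  open CommutativeRing S
  open import Algebra.Properties.CommutativeSemiring.Exp commutativeSemiring public
    using (_^_; ^-congˡ; ^-congʳ; ^-homo-*; ^-assocʳ; ^-distrib-*)
  open import Relation.Binary.Reasoning.Setoid setoid
  open IntegerSolver S

  poch : Carrier → Carrier → ℕ → Carrier
  poch a b zero    = 1#
  poch a b (suc k) = (1# - a * b ^ k) * poch a b k

  poch-cong : ∀ {a a′ b b′} k → a ≈ a′ → b ≈ b′ → poch a b k ≈ poch a′ b′ k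
  poch-cong zero    a≈ b≈ = refl
  poch-cong (suc k) a≈ b≈ =
    *-cong (+-congˡ (-‿cong (*-cong a≈ (^-congˡ k b≈)))) (poch-cong k a≈ b≈)

  module _ (f : Carrier → Carrier) (f-cong : ∀ {w w′} → w ≈ w′ → f w ≈ f w′) (a b : Carrier)
           (step : ∀ w → f w ≈ (1# - a * w) * f (w * b)) where

    poch-iterate : ∀ k w → f w ≈ poch (a * w) b k * f (w * b ^ k)
    poch-iterate zero    w = trans (f-cong (sym (*-identityʳ w))) (sym (*-identityˡ _))
    poch-iterate (suc k) w = begin
      f w
        ≈⟨ poch-iterate k w ⟩
      poch (a * w) b k * f (w * b ^ k)
        ≈⟨ *-congˡ (step _) ⟩
      poch (a * w) b k * ((1# - a * (w * b ^ k)) * f (w * b ^ k * b))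
        ≈⟨ *-congˡ (*-congˡ (f-cong (trans (*-assoc w _ b) (*-congˡ (*-comm _ b))))) ⟩
      poch (a * w) b k * ((1# - a * (w * b ^ k)) * f (w * b ^ suc k))
        ≈⟨ solve 5 (λ P a w B F → P :* ((:1 :- a :* (w :* B)) :* F) := (:1 :- a :* w :* B) :* P :* F)
             refl (poch (a * w) b k) a w (b ^ k) (f (w * b ^ suc k)) ⟩
      poch (a * w) b (suc k) * f (w * b ^ suc k) ∎

    -- Nilpotency of b replaces convergence: after k steps the argument w b^k is 0 itself.
    poch-limit : ∀ k → b ^ k ≈ 0# → ∀ w → f w ≈ poch (a * w) b k * f 0#
    poch-limit k bᵏ≈0 w =
      trans (poch-iterate k w) (*-congˡ (f-cong (trans (*-congˡ bᵏ≈0) (zeroʳ w))))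

-- Transfer recurrences for 0/1 sequences

module Transfer {c ℓ} (S : CommutativeRing c ℓ) (Q : CommutativeRing.Carrier S) where
  open CommutativeRing S
  open Pochhammer S
  open import Relation.Binary.Reasoning.Setoid setoid
  open IntegerSolver S

  -- Generating functions of 0/1 sequences with places 0, …, k - 1, where a 1 at
  -- place j weighs z Qʲ and a 1 coming after a 0 weighs a further 1 - w; the
  -- sequence is preceded by a 0 for A and by a 1 for B.
  A B : ℕ → Carrier → Carrier → Carrier
  A zero    z w = 1#
  A (suc k) z w = A k (z * Q) w + (1# - w) * (z * B k (z * Q) w)
  B zero    z w = 1#
  B (suc k) z w = A k (z * Q) w + z * B k (z * Q) w

  A-cong : ∀ k {z z′ w w′} → z ≈ z′ → w ≈ w′ → A k z w ≈ A k z′ w′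
  B-cong : ∀ k {z z′ w w′} → z ≈ z′ → w ≈ w′ → B k z w ≈ B k z′ w′
  A-cong zero    z≈ w≈ = refl
  A-cong (suc k) z≈ w≈ = +-cong (A-cong k (*-congʳ z≈) w≈)
    (*-cong (+-congˡ (-‿cong w≈)) (*-cong z≈ (B-cong k (*-congʳ z≈) w≈)))
  B-cong zero    z≈ w≈ = refl
  B-cong (suc k) z≈ w≈ =
    +-cong (A-cong k (*-congʳ z≈) w≈) (*-cong z≈ (B-cong k (*-congʳ z≈) w≈))

  private
    shift : ∀ z k → z * Q ^ suc k ≈ 0# → z * Q * Q ^ k ≈ 0#
    shift z k h = trans (*-assoc z Q _) h

  -- A 1 at the additional place k would weigh z Q^k = 0.
  A-stable : ∀ k z w → z * Q ^ k ≈ 0# → A (suc k) z w ≈ A k z w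
  B-stable : ∀ k z w → z * Q ^ k ≈ 0# → B (suc k) z w ≈ B k z w
  A-stable zero z w h = begin
    1# + (1# - w) * (z * 1#)   ≈⟨ +-congˡ (*-congˡ h) ⟩
    1# + (1# - w) * 0#         ≈⟨ trans (+-congˡ (zeroʳ _)) (+-identityʳ 1#) ⟩
    1#                         ∎
  A-stable (suc k) z w h = +-cong (A-stable k (z * Q) w (shift z k h))
    (*-congˡ (*-congˡ (B-stable k (z * Q) w (shift z k h))))
  B-stable zero z w h = trans (+-congˡ h) (+-identityʳ 1#)
  B-stable (suc k) z w h = +-cong (A-stable k (z * Q) w (shift z k h))
    (*-congˡ (B-stable k (z * Q) w (shift z k h)))

  -- The two relations carry one induction: unfolding the first by one place, and using it at zQ,
  -- leaves exactly the second. The second stays multiplied by z because z cannot be cancelled. Its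
  -- base case has the error term w z Q, which the vanishing hypothesis removes.
  A-shift : ∀ k z w → z * Q ^ k ≈ 0# → A k z (w * Q) ≈ B k z w
  B-shift : ∀ k z w → z * Q ^ suc k ≈ 0# →
            z * ((1# - w * Q) * B k (z * Q) (w * Q)) ≈ A k (z * Q) w - (1# - z) * B k (z * Q) w
  A-shift zero    z w h = refl
  A-shift (suc k) z w h = begin
    A k (z * Q) (w * Q) + (1# - w * Q) * (z * b′)
      ≈⟨ +-cong (A-shift k (z * Q) w (shift z k h))
           (solve 3 (λ v z b → v :* (z :* b) := z :* (v :* b)) refl (1# - w * Q) z b′) ⟩
    b + z * ((1# - w * Q) * b′)
      ≈⟨ +-congˡ (B-shift k z w h) ⟩
    b + (a - (1# - z) * b)
      ≈⟨ solve 3 (λ a b z → b :+ (a :- (:1 :- z) :* b) := a :+ z :* b) refl a b z ⟩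
    a + z * b ∎
    where
    a = A k (z * Q) w
    b = B k (z * Q) w
    b′ = B k (z * Q) (w * Q)
  B-shift zero z w h = begin
    z * ((1# - w * Q) * 1#)
      ≈⟨ solve 3 (λ z w Q → z :* ((:1 :- w :* Q) :* :1) := :1 :- (:1 :- z) :* :1 :- w :* (z :* (Q :* :1)))
           refl z w Q ⟩
    1# - (1# - z) * 1# - w * (z * (Q * 1#))
      ≈⟨ +-congˡ (-‿cong (trans (*-congˡ h) (zeroʳ w))) ⟩
    1# - (1# - z) * 1# - 0#
      ≈⟨ solve 1 (λ z → :1 :- (:1 :- z) :* :1 :- con (ℤ.+ 0) := :1 :- (:1 :- z) :* :1) refl z ⟩
    1# - (1# - z) * 1# ∎
  B-shift (suc k) z w h = begin
    z * ((1# - w * Q) * (A k (z * Q * Q) (w * Q) + z * Q * b′))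
      ≈⟨ *-congˡ (*-congˡ (+-congʳ (A-shift k (z * Q * Q) w (shift (z * Q) k (shift z (suc k) h))))) ⟩
    z * ((1# - w * Q) * (b + z * Q * b′))
      ≈⟨ solve 5 (λ z w Q b b′ → z :* ((:1 :- w :* Q) :* (b :+ z :* Q :* b′))
                 := z :* ((:1 :- w :* Q) :* b) :+ z :* (z :* Q :* ((:1 :- w :* Q) :* b′))) refl z w Q b b′ ⟩
    z * ((1# - w * Q) * b) + z * (z * Q * ((1# - w * Q) * b′))
      ≈⟨ +-congˡ (*-congˡ (B-shift k (z * Q) w (shift z (suc k) h))) ⟩
    z * ((1# - w * Q) * b) + z * (a - (1# - z * Q) * b)
      ≈⟨ solve 5 (λ z w Q a b → z :* ((:1 :- w :* Q) :* b) :+ z :* (a :- (:1 :- z :* Q) :* b)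
                 := a :+ (:1 :- w) :* (z :* Q :* b) :- (:1 :- z) :* (a :+ z :* Q :* b)) refl z w Q a b ⟩
    a + (1# - w) * (z * Q * b) - (1# - z) * (a + z * Q * b) ∎
    where
    a = A k (z * Q * Q) w
    b = B k (z * Q * Q) w
    b′ = B k (z * Q * Q) (w * Q)

-- Shift equations for the residues 0, ±c and t/2

module Runner {c ℓ} (S : CommutativeRing c ℓ) (Q : CommutativeRing.Carrier S)
              (K : ℕ) (Qᴷ≈0 : CommutativeRing._≈_ S (Pochhammer._^_ S Q K) (CommutativeRing.0# S)) where
  open CommutativeRing S
  open Pochhammer S
  open Transfer S Q
  open import Relation.Binary.Reasoning.Setoid setoid
  open IntegerSolver S

  -- Since Q^K = 0, K places stand for infinitely many, and the recurrences below no longer mention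
  -- a length.
  𝒜 ℬ : Carrier → Carrier → Carrier
  𝒜 = A K
  ℬ = B K

  𝒜-cong : ∀ {z z′ w w′} → z ≈ z′ → w ≈ w′ → 𝒜 z w ≈ 𝒜 z′ w′
  𝒜-cong = A-cong K
  ℬ-cong : ∀ {z z′ w w′} → z ≈ z′ → w ≈ w′ → ℬ z w ≈ ℬ z′ w′
  ℬ-cong = B-cong K

  private
    vanish : ∀ z → z * Q ^ K ≈ 0#
    vanish z = trans (*-congˡ Qᴷ≈0) (zeroʳ z)

  𝒜-rec : ∀ z w → 𝒜 z w ≈ 𝒜 (z * Q) w + (1# - w) * (z * ℬ (z * Q) w)
  𝒜-rec z w = sym (A-stable K z w (vanish z))

  ℬ-rec : ∀ z w → ℬ z w ≈ 𝒜 (z * Q) w + z * ℬ (z * Q) w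
  ℬ-rec z w = sym (B-stable K z w (vanish z))

  𝒜-shift : ∀ z w → 𝒜 z (w * Q) ≈ ℬ z w
  𝒜-shift z w = A-shift K z w (vanish z)

  ℬ-shift : ∀ z w → z * ((1# - w * Q) * ℬ (z * Q) (w * Q)) ≈ 𝒜 (z * Q) w - (1# - z) * ℬ (z * Q) w
  ℬ-shift z w = B-shift K z w (trans (sym (*-assoc z Q _)) (vanish (z * Q)))

  𝒜-zero : ∀ {z} w → z ≈ 0# → 𝒜 z w ≈ 1#
  𝒜-zero w z≈0 = go K z≈0
    where
    go : ∀ k {z} → z ≈ 0# → A k z w ≈ 1#
    go zero    _ = refl
    go (suc k) z≈0 = trans
      (+-cong (go k (trans (*-congʳ z≈0) (zeroˡ Q))) (trans (*-congˡ (trans (*-congʳ z≈0) (zeroˡ _))) (zeroʳ _)))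
      (+-identityʳ 1#)

  ℬ-zero : ∀ {z} w → z ≈ 0# → ℬ z w ≈ 1#
  ℬ-zero {z} w z≈0 = begin
    ℬ z w                          ≈⟨ ℬ-rec z w ⟩
    𝒜 (z * Q) w + z * ℬ (z * Q) w  ≈⟨ +-cong (𝒜-zero w (trans (*-congʳ z≈0) (zeroˡ Q)))
                                            (trans (*-congʳ z≈0) (zeroˡ _)) ⟩
    1# + 0#                        ≈⟨ +-identityʳ 1# ⟩
    1#                             ∎

  -- The row vector (1, x) is a left eigenvector, with eigenvalue 1 + x, of the transfer matrix with
  -- rows (1, x²) and (1, 1). This is the origin of the factor 1/(1+x) in D*.
  𝒜+xℬ : ∀ x z w → x * x ≈ 1# - w →
         𝒜 z w + x * ℬ z w ≈ (1# + x) * (𝒜 (z * Q) w + x * (z * ℬ (z * Q) w))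
  𝒜+xℬ x z w x² = begin
    𝒜 z w + x * ℬ z w
      ≈⟨ +-cong (𝒜-rec z w) (*-congˡ (ℬ-rec z w)) ⟩
    (a + (1# - w) * (z * b)) + x * (a + z * b)
      ≈⟨ +-congʳ (+-congˡ (*-congʳ (sym x²))) ⟩
    (a + (x * x) * (z * b)) + x * (a + z * b)
      ≈⟨ solve 4 (λ a b x z → (a :+ (x :* x) :* (z :* b)) :+ x :* (a :+ z :* b)
                 := (:1 :+ x) :* (a :+ x :* (z :* b))) refl a b x z ⟩
    (1# + x) * (a + x * (z * b)) ∎
    where
    a = 𝒜 (z * Q) w
    b = ℬ (z * Q) w

  -- At z = 1 the term (1 - z) ℬ of `ℬ-shift` disappears. The remaining relation leads from 𝒜 to ℬ,
  -- and `𝒜-shift` leads back at the cost of a second Q; hence the base Q² = q^(4t) in D*.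
  𝒜-one : ∀ w → 𝒜 Q w ≈ (1# - Q * w) * 𝒜 Q (w * (Q * Q))
  𝒜-one w = begin
    𝒜 Q w
      ≈⟨ 𝒜-cong (sym (*-identityˡ Q)) refl ⟩
    𝒜 (1# * Q) w
      ≈⟨ solve 2 (λ a b → a := a :- (:1 :- :1) :* b) refl (𝒜 (1# * Q) w) (ℬ (1# * Q) w) ⟩
    𝒜 (1# * Q) w - (1# - 1#) * ℬ (1# * Q) w
      ≈⟨ ℬ-shift 1# w ⟨
    1# * ((1# - w * Q) * ℬ (1# * Q) (w * Q))
      ≈⟨ trans (*-identityˡ _) (*-cong (+-congˡ (-‿cong (*-comm w Q)))
           (ℬ-cong (*-identityˡ Q) refl)) ⟩
    (1# - Q * w) * ℬ Q (w * Q)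
      ≈⟨ *-congˡ (trans (sym (𝒜-shift Q (w * Q))) (𝒜-cong refl (*-assoc w Q Q))) ⟩
    (1# - Q * w) * 𝒜 Q (w * (Q * Q)) ∎

  -- Generating function of a pair of runners c and t - c, for a = q^{2c} and
  -- b = q^{2(t-c)}.
  𝒢 : Carrier → Carrier → Carrier → Carrier
  𝒢 a b w = 𝒜 (a * Q) w * (𝒜 (b * Q) w + b * ℬ (b * Q) w)
          + a * (ℬ (a * Q) w * (𝒜 (b * Q) w + (1# - w) * (b * ℬ (b * Q) w)))

  𝒢-cong : ∀ {a a′ b b′ w w′} → a ≈ a′ → b ≈ b′ → w ≈ w′ → 𝒢 a b w ≈ 𝒢 a′ b′ w′
  𝒢-cong a≈ b≈ w≈ = +-cong
    (*-cong (𝒜-cong (*-congʳ a≈) w≈) (+-cong (𝒜-cong (*-congʳ b≈) w≈) (*-cong b≈ (ℬ-cong (*-congʳ b≈) w≈))))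
    (*-cong a≈ (*-cong (ℬ-cong (*-congʳ a≈) w≈)
      (+-cong (𝒜-cong (*-congʳ b≈) w≈)
        (*-cong (+-congˡ (-‿cong w≈)) (*-cong b≈ (ℬ-cong (*-congʳ b≈) w≈))))))

  𝒢-shift : ∀ a b w → a * b ≈ Q → 𝒢 a b w ≈ (1# - Q * w) * 𝒢 a b (w * Q)
  𝒢-shift a b w ab≈Q = sym (begin
    (1# - Q * w) * 𝒢 a b (w * Q)
      ≈⟨ *-cong (+-congˡ (-‿cong (*-comm Q w)))
           (+-cong (*-cong 𝒜a (+-congʳ 𝒜b)) (*-congˡ (*-congˡ (+-congʳ 𝒜b)))) ⟩
    (1# - v) * (a₁ * (b₁ + b * β) + a * (α * (b₁ + (1# - v) * (b * β))))
      -- Both α and β need a factor 1 - v before `ℬ-shift` applies. Where they occur together, the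
      -- weight 1 - v of the pair itself supplies the second one.
      ≈⟨ solve 7 (λ v a b a₁ b₁ α β →
           (:1 :- v) :* (a₁ :* (b₁ :+ b :* β) :+ a :* (α :* (b₁ :+ (:1 :- v) :* (b :* β))))
           := a₁ :* ((:1 :- v) :* b₁ :+ b :* ((:1 :- v) :* β))
              :+ (a :* ((:1 :- v) :* α)) :* (b₁ :+ b :* ((:1 :- v) :* β)))
           refl v a b a₁ b₁ α β ⟩
    a₁ * ((1# - v) * b₁ + b * ((1# - v) * β)) + (a * ((1# - v) * α)) * (b₁ + b * ((1# - v) * β))
      -- The one factor 1 - v left over is rewritten with Q = ab; only then do the two sides agree
      -- as polynomials.
      ≈⟨ +-cong (*-congˡ (+-cong (*-congʳ (+-congˡ (-‿cong v≈))) (ℬ-shift b w)))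
           (*-cong (ℬ-shift a w) (+-congˡ (ℬ-shift b w))) ⟩
    a₁ * ((1# - w * (a * b)) * b₁ + (b₀ - (1# - b) * b₁)) + (a₀ - (1# - a) * a₁) * (b₁ + (b₀ - (1# - b) * b₁))
      ≈⟨ solve 7 (λ w a b a₀ a₁ b₀ b₁ →
           a₁ :* ((:1 :- w :* (a :* b)) :* b₁ :+ (b₀ :- (:1 :- b) :* b₁))
             :+ (a₀ :- (:1 :- a) :* a₁) :* (b₁ :+ (b₀ :- (:1 :- b) :* b₁))
           := a₀ :* (b₀ :+ b :* b₁) :+ a :* (a₁ :* (b₀ :+ (:1 :- w) :* (b :* b₁))))
           refl w a b a₀ a₁ b₀ b₁ ⟩
    𝒢 a b w ∎)
    where
    v = w * Q
    v≈ : v ≈ w * (a * b)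
    v≈ = *-congˡ (sym ab≈Q)
    a₀ = 𝒜 (a * Q) w
    a₁ = ℬ (a * Q) w
    b₀ = 𝒜 (b * Q) w
    b₁ = ℬ (b * Q) w
    α = ℬ (a * Q) v
    β = ℬ (b * Q) v
    𝒜a = 𝒜-shift (a * Q) w
    𝒜b = 𝒜-shift (b * Q) w

  -- A solution of Y(c) = (1 - c) Y(-pc) whose even and odd parts in c are
  -- 𝒜(p) and -c 𝒜(pQ), for p² = Q.
  module SelfPaired (p : Carrier) (p²≈Q : p * p ≈ Q) where

    Y : Carrier → Carrier
    Y c = 𝒜 p (c * c) - c * 𝒜 (p * Q) (c * c)

    Y-cong : ∀ {c c′} → c ≈ c′ → Y c ≈ Y c′
    Y-cong c≈ = +-cong (𝒜-cong refl (*-cong c≈ c≈))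
      (-‿cong (*-cong c≈ (𝒜-cong refl (*-cong c≈ c≈))))

    -- Passing from c to ±pc multiplies w = c² by Q, which turns 𝒜 into ℬ. The minus sign is forced
    -- by the odd part and becomes the base -q of H*.
    Y-step : ∀ c → Y c ≈ (1# - 1# * c) * Y (c * - p)
    Y-step c = begin
      𝒜 p (c * c) - c * a
        ≈⟨ +-congʳ (𝒜-rec p (c * c)) ⟩
      (a + (1# - c * c) * (p * b)) - c * a
        ≈⟨ solve 4 (λ a b c p → (a :+ (:1 :- c :* c) :* (p :* b)) :- c :* a
             := (:1 :- :1 :* c) :* ((a :+ p :* b) :- (c :* :- p) :* b)) refl a b c p ⟩
      (1# - 1# * c) * ((a + p * b) - (c * - p) * b)
        ≈⟨ *-congˡ (+-cong (trans (sym (ℬ-rec p (c * c))) (even p))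
             (-‿cong (*-congˡ (even (p * Q))))) ⟩
      (1# - 1# * c) * Y (c * - p) ∎
      where
      a = 𝒜 (p * Q) (c * c)
      b = ℬ (p * Q) (c * c)
      even : ∀ z → ℬ z (c * c) ≈ 𝒜 z (c * - p * (c * - p))
      even z = trans (sym (𝒜-shift z (c * c))) (𝒜-cong refl (trans (*-congˡ (sym p²≈Q))
        (solve 2 (λ c p → c :* c :* (p :* p) := c :* :- p :* (c :* :- p)) refl c p)))

    Y-zero : Y 0# ≈ 𝒜 p 0#
    Y-zero = trans (+-cong (𝒜-cong refl (zeroˡ 0#)) (trans (-‿cong (zeroˡ _)) -0#≈0#)) (+-identityʳ _)
      where open import Algebra.Properties.Ring ring using (-0#≈0#)

    -- Multiplying by x replaces x ℬ by (1 - w) ℬ(p) = 𝒜(p) - w 𝒜(pQ), so only the even and odd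
    -- parts of Y remain. They are recovered from Y(r) and Y(-r), whence the denominator 2x in H*.
    Y-sum : ∀ x r w → x * x ≈ 1# - w → r * r ≈ w →
            ((1# + 1#) * x) * (𝒜 p w + x * ℬ p w) ≈ (1# + x - r) * Y (- r) + (1# + x + r) * Y r
    Y-sum x r w x² r² = begin
      ((1# + 1#) * x) * (𝒜 p w + x * ℬ p w)
        ≈⟨ *-congˡ (+-cong (𝒜-rec p w) (*-congˡ (ℬ-rec p w))) ⟩
      ((1# + 1#) * x) * ((a + (1# - w) * (p * b)) + x * (a + p * b))
        ≈⟨ solve 5 (λ a b x w p → ((:1 :+ :1) :* x) :* ((a :+ (:1 :- w) :* (p :* b)) :+ x :* (a :+ p :* b))
             := (:1 :+ :1) :* (x :* (a :+ (:1 :- w) :* (p :* b)) :+ (x :* x) :* (a :+ p :* b)))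
             refl a b x w p ⟩
      (1# + 1#) * (x * (a + (1# - w) * (p * b)) + (x * x) * (a + p * b))
        ≈⟨ *-congˡ (+-congˡ (*-congʳ x²)) ⟩
      (1# + 1#) * (x * (a + (1# - w) * (p * b)) + (1# - w) * (a + p * b))
        ≈⟨ solve 5 (λ a b x w p →
             (:1 :+ :1) :* (x :* (a :+ (:1 :- w) :* (p :* b)) :+ (:1 :- w) :* (a :+ p :* b))
             := (:1 :+ :1) :* ((:1 :+ x) :* (a :+ (:1 :- w) :* (p :* b)) :- w :* a))
             refl a b x w p ⟩
      (1# + 1#) * ((1# + x) * (a + (1# - w) * (p * b)) - w * a)
        ≈⟨ *-congˡ (+-cong (*-congˡ (sym (𝒜-rec p w))) (-‿cong (*-congʳ (sym r²)))) ⟩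
      (1# + 1#) * ((1# + x) * 𝒜 p w - r * r * a)
        ≈⟨ solve 4 (λ A a x r → (:1 :+ :1) :* ((:1 :+ x) :* A :- r :* r :* a)
             := (:1 :+ x :- r) :* (A :- (:- r) :* a) :+ (:1 :+ x :+ r) :* (A :- r :* a))
             refl (𝒜 p w) a x r ⟩
      (1# + x - r) * (𝒜 p w - (- r) * a) + (1# + x + r) * (𝒜 p w - r * a)
        ≈⟨ +-cong (*-congˡ (parity (- r) (trans (solve 1 (λ r → :- r :* :- r := r :* r) refl r) r²)))
             (*-congˡ (parity r r²)) ⟩
      (1# + x - r) * Y (- r) + (1# + x + r) * Y r ∎
      where
      a = 𝒜 (p * Q) w
      b = ℬ (p * Q) w
      parity : ∀ c → c * c ≈ w → 𝒜 p w - c * a ≈ Y c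
      parity c c² = +-cong (𝒜-cong refl (sym c²)) (-‿cong (*-congˡ (𝒜-cong refl (sym c²))))

-- Hooks of doubled partitions on the boundary path

module Hooks where
  open import Data.Nat.Base using (_+_; _*_)
  open ≡ using (refl; sym; trans; cong; cong₂; subst)

  -- A partition is read off its boundary path, from the top right to the bottom
  -- left: true is the right end of a row, false the bottom end of a column.

  zeros : List Bool → ℕ
  zeros []          = 0
  zeros (true  ∷ W) = zeros W
  zeros (false ∷ W) = suc (zeros W)

  rows : List Bool → List ℕ
  rows []          = []
  rows (true  ∷ W) = zeros W ∷ rows W
  rows (false ∷ W) = rows W

  at : ℕ → List Bool → Maybe Bool
  at _       []      = nothing
  at zero    (b ∷ W) = just b
  at (suc i) (b ∷ W) = at i W

  isTrue isFalse : Maybe Bool → ℕ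
  isTrue (just true) = 1
  isTrue _           = 0
  isFalse (just false) = 1
  isFalse _            = 0

  -- Counts pairs at distance s + 1, not s.
  descents : ℕ → List Bool → ℕ
  descents s []          = 0
  descents s (true  ∷ W) = isFalse (at s W) + descents s W
  descents s (false ∷ W) = descents s W

  rows≤zeros : ∀ W → All (_≤ zeros W) (rows W)
  rows≤zeros []          = []
  rows≤zeros (true  ∷ W) = ℕ.≤-refl ∷ rows≤zeros W
  rows≤zeros (false ∷ W) = All.map ℕ.m≤n⇒m≤1+n (rows≤zeros W)

  count-++ : ∀ {p} {P : Pred ℕ p} (P? : Decidable P) xs ys →
             count P? (xs ++ ys) ≡ count P? xs + count P? ys
  count-++ P? xs ys = trans (cong length (filter-++ P? xs ys)) (length-++ (filter P? xs))

  applyUpTo-cong : ∀ {A : Set} {f g : ℕ → A} n → (∀ j → j < n → f j ≡ g j) → applyUpTo f n ≡ applyUpTo g n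
  applyUpTo-cong zero    _ = refl
  applyUpTo-cong (suc n) e = cong₂ _∷_ (e 0 (s≤s z≤n)) (applyUpTo-cong n (λ j j<n → e (suc j) (s≤s j<n)))

  rowHook : List Bool → ℕ → ℕ
  rowHook W j = 1 + (zeros W ∸ suc j) + count (j <?_) (rows W)

  -- Prefixing a step to W lengthens every hook of the row by one box: a row end lengthens the leg,
  -- a column end the arm. A column end also creates one new box, of hook length 1.
  rowHook-true : ∀ W j → j < zeros W → rowHook (true ∷ W) j ≡ suc (rowHook W j)
  rowHook-true W j j<z = trans
    (cong (λ xs → 1 + (zeros W ∸ suc j) + length xs) (filter-accept (j <?_) j<z))
    (ℕ.+-suc (1 + (zeros W ∸ suc j)) _)

  rowHook-false : ∀ W j → j < zeros W → rowHook (false ∷ W) j ≡ suc (rowHook W j)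
  rowHook-false W j j<z = cong (λ k → 1 + k + count (j <?_) (rows W)) (ℕ.+-∸-assoc 1 j<z)

  rowHook-corner : ∀ W → rowHook (false ∷ W) (zeros W) ≡ 1
  rowHook-corner W = cong₂ (λ k xs → 1 + k + length xs) (ℕ.n∸n≡0 (zeros W))
    (filter-none (zeros W <?_) (All.map ℕ.≤⇒≯ (rows≤zeros W)))

  -- The hook lengths of a row are the distances from its end to the later column
  -- ends.
  rowHooks : List Bool → List ℕ
  rowHooks W = applyUpTo (rowHook W) (zeros W)

  rowHooks-true : ∀ W → rowHooks (true ∷ W) ≡ map suc (rowHooks W)
  rowHooks-true W = trans (applyUpTo-cong (zeros W) (rowHook-true W))
    (sym (map-applyUpTo (rowHook W) suc (zeros W)))

  rowHooks-false : ∀ W → rowHooks (false ∷ W) ≡ map suc (rowHooks W) ∷ʳ 1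
  rowHooks-false W = trans (sym (applyUpTo-∷ʳ (rowHook (false ∷ W)) (zeros W)))
    (cong₂ _∷ʳ_
      (trans (applyUpTo-cong (zeros W) (rowHook-false W)) (sym (map-applyUpTo (rowHook W) suc (zeros W))))
      (rowHook-corner W))

  -- Index 0 of W is at distance 1 from the row end before it, so index s corresponds to hook length
  -- s + 1.
  count-rowHooks : ∀ s W → count (_≟ suc s) (rowHooks W) ≡ isFalse (at s W)
  count-map-rowHooks : ∀ s W → count (_≟ suc s) (map suc (rowHooks W)) ≡ isFalse (at s (true ∷ W))

  count-rowHooks s []          = refl
  count-rowHooks s (true  ∷ W) = trans (cong (count (_≟ suc s)) (rowHooks-true W)) (count-map-rowHooks s W)
  count-rowHooks s (false ∷ W) = trans (cong (count (_≟ suc s)) (rowHooks-false W))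
    (trans (count-++ (_≟ suc s) (map suc (rowHooks W)) (1 ∷ []))
      (trans (cong (_+ count (_≟ suc s) (1 ∷ [])) (count-map-rowHooks s W)) (corner s)))
    where
    corner : ∀ s → isFalse (at s (true ∷ W)) + count (_≟ suc s) (1 ∷ []) ≡ isFalse (at s (false ∷ W))
    corner zero    = refl
    corner (suc s) = ℕ.+-identityʳ _

  count-map-rowHooks zero W = trans
    (count-map-suc (_≟ 1) (_≟ 0) (λ _ → ℕ.suc-injective) (λ _ → cong suc) (rowHooks W))
    -- Every hook length is a successor, so no entry is 0.
    (trans (cong (count (_≟ 0)) (sym (map-applyUpTo _ suc (zeros W))))
      (count-none (_≟ 0) (λ _ ()) (applyUpTo _ (zeros W))))
  count-map-rowHooks (suc s) W = trans
    (count-map-suc (_≟ suc (suc s)) (_≟ suc s) (λ _ → ℕ.suc-injective) (λ _ → cong suc) (rowHooks W))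
    (count-rowHooks s W)

  hookCount-rows : ∀ s W → hookCount (suc s) (rows W) ≡ descents s W
  hookCount-rows s []          = refl
  hookCount-rows s (false ∷ W) = hookCount-rows s W
  hookCount-rows s (true  ∷ W) = trans
    (count-++ (_≟ suc s) (map (rowHook W) (upTo (zeros W))) (hookLengths (rows W)))
    (cong₂ _+_
      (trans (cong (count (_≟ suc s)) (map-upTo (rowHook W) (zeros W))) (count-rowHooks s W))
      (hookCount-rows s W))

  -- The entries of ε : Vec Bool m say which of m, m - 1, …, 1 are parts.

  parts : ∀ {m} → Vec Bool m → List ℕ
  parts []                    = []
  parts {suc m} (true  ∷ ε) = suc m ∷ parts ε
  parts         (false ∷ ε) = parts ε

  bit : ∀ {m} → ℕ → Vec Bool m → Bool
  bit j []                = false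
  bit j (_∷_ {m} b ε) = if does (j ≟ suc m) then b else bit j ε

  bit-top : ∀ {m} b (ε : Vec Bool m) → bit (suc m) (b ∷ ε) ≡ b
  bit-top {m} b ε = cong (λ d → if d then b else bit (suc m) ε) (dec-true (suc m ≟ suc m) refl)

  bit-below : ∀ {m} b (ε : Vec Bool m) {j} → j ≤ m → bit j (b ∷ ε) ≡ bit j ε
  bit-below {m} b ε {j} j≤m =
    cong (λ d → if d then b else bit j ε) (dec-false (j ≟ suc m) (ℕ.<⇒≢ (s≤s j≤m)))

  parts-strict : ∀ {m} (ε : Vec Bool m) → StrictPartition (parts ε)
  parts≤ : ∀ {m} (ε : Vec Bool m) → All (_≤ m) (parts ε)
  parts-strict []          = [] , []
  parts-strict (true  ∷ ε) = strict-cons (s≤s z≤n) (All.map s≤s (parts≤ ε)) (parts-strict ε)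
  parts-strict (false ∷ ε) = parts-strict ε
  parts≤ []          = []
  parts≤ (true  ∷ ε) = ℕ.≤-refl ∷ All.map ℕ.m≤n⇒m≤1+n (parts≤ ε)
  parts≤ (false ∷ ε) = All.map ℕ.m≤n⇒m≤1+n (parts≤ ε)

  -- The boundary path of the doubled partition, invariant under reversing and
  -- complementing except for its middle entry.
  path : ∀ {m} → Vec Bool m → List Bool
  path []      = false ∷ []
  path (b ∷ ε) = b ∷ (path ε ∷ʳ not b)

  length-path : ∀ {m} (ε : Vec Bool m) → length (path ε) ≡ suc (m + m)
  length-path []              = refl
  length-path (_∷_ {m} b ε) = cong suc (trans (length-++ (path ε))
    (trans (ℕ.+-comm _ 1) (cong suc (trans (length-path ε) (sym (ℕ.+-suc m m))))))

  zeros-∷ʳ-false : ∀ W → zeros (W ∷ʳ false) ≡ suc (zeros W)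
  zeros-∷ʳ-false []          = refl
  zeros-∷ʳ-false (true  ∷ W) = zeros-∷ʳ-false W
  zeros-∷ʳ-false (false ∷ W) = cong suc (zeros-∷ʳ-false W)

  zeros-∷ʳ-true : ∀ W → zeros (W ∷ʳ true) ≡ zeros W
  zeros-∷ʳ-true []          = refl
  zeros-∷ʳ-true (true  ∷ W) = zeros-∷ʳ-true W
  zeros-∷ʳ-true (false ∷ W) = cong suc (zeros-∷ʳ-true W)

  rows-∷ʳ-false : ∀ W → rows (W ∷ʳ false) ≡ map suc (rows W)
  rows-∷ʳ-false []          = refl
  rows-∷ʳ-false (true  ∷ W) = cong₂ _∷_ (zeros-∷ʳ-false W) (rows-∷ʳ-false W)
  rows-∷ʳ-false (false ∷ W) = rows-∷ʳ-false W

  rows-∷ʳ-true : ∀ W → rows (W ∷ʳ true) ≡ rows W ∷ʳ 0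
  rows-∷ʳ-true []          = refl
  rows-∷ʳ-true (true  ∷ W) = cong₂ _∷_ (zeros-∷ʳ-true W) (rows-∷ʳ-true W)
  rows-∷ʳ-true (false ∷ W) = rows-∷ʳ-true W

  zeros-path : ∀ {m} (ε : Vec Bool m) → zeros (path ε) ≡ suc m
  zeros-path []          = refl
  zeros-path (true  ∷ ε) = trans (zeros-∷ʳ-false (path ε)) (cong suc (zeros-path ε))
  zeros-path (false ∷ ε) = cong suc (trans (zeros-∷ʳ-true (path ε)) (zeros-path ε))

  -- Counting m rows, not just as many as the first part, makes the induction go through: a top bit
  -- `false` contributes an empty row at the bottom. A top bit `true` contributes a first row of
  -- length m + 2 and a new column, which lengthens the m old rows by one box each.
  rows-path : ∀ {m} (ε : Vec Bool m) → rows (path ε) ≡ applyUpTo (doubledRow (parts ε)) m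
  rows-path []                    = refl
  rows-path {suc m} (false ∷ ε) = begin
    rows (path ε ∷ʳ true)                            ≡⟨ rows-∷ʳ-true (path ε) ⟩
    rows (path ε) ∷ʳ 0                               ≡⟨ cong₂ _∷ʳ_ (rows-path ε)
                                                          (sym (doubledRow-beyond (parts-strict ε) m (parts≤ ε))) ⟩
    applyUpTo (doubledRow (parts ε)) m ∷ʳ doubledRow (parts ε) m  ≡⟨ applyUpTo-∷ʳ (doubledRow (parts ε)) m ⟩
    applyUpTo (doubledRow (parts ε)) (suc m)         ∎
    where open ≡.≡-Reasoning
  rows-path {suc m} (true ∷ ε) = cong₂ _∷_
    (trans (zeros-∷ʳ-false (path ε)) (trans (cong suc (zeros-path ε))
      (sym (doubledRow-zero (suc m) (parts ε) (s≤s z≤n)))))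
    (begin
      rows (path ε ∷ʳ false)                             ≡⟨ rows-∷ʳ-false (path ε) ⟩
      map suc (rows (path ε))                            ≡⟨ cong (map suc) (rows-path ε) ⟩
      map suc (applyUpTo (doubledRow (parts ε)) m)       ≡⟨ map-applyUpTo (doubledRow (parts ε)) suc m ⟩
      applyUpTo (suc ∘ doubledRow (parts ε)) m           ≡⟨ applyUpTo-cong m (λ r r<m → sym (lengthen r r<m)) ⟩
      applyUpTo (doubledRow (suc m ∷ parts ε) ∘ suc) m   ∎)
    where
    open ≡.≡-Reasoning
    lengthen : ∀ r → r < m → doubledRow (suc m ∷ parts ε) (suc r) ≡ suc (doubledRow (parts ε) r)
    lengthen r r<m = trans (doubledRow-suc (suc m) (parts ε) r)
      (cong (λ xs → length xs + doubledRow (parts ε) r) (filter-accept (suc r <?_) {xs = []} (s≤s r<m)))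

  descents-∷ʳ-true : ∀ s W → descents s (W ∷ʳ true) ≡ descents s W
  descents-∷ʳ-true s []          = refl
  descents-∷ʳ-true s (false ∷ W) = descents-∷ʳ-true s W
  descents-∷ʳ-true s (true  ∷ W) = cong₂ _+_ (same s W) (descents-∷ʳ-true s W)
    where
    same : ∀ s W → isFalse (at s (W ∷ʳ true)) ≡ isFalse (at s W)
    same zero    []      = refl
    same (suc s) []      = refl
    same zero    (_ ∷ W) = refl
    same (suc s) (_ ∷ W) = same s W

  -- Top bits `false` are stripped first; they affect neither side. Once the top bit is `true`, the
  -- first part equals the number of places and `rows-path` describes `doubled` itself.
  hookCount-doubled : ∀ {m} s (ε : Vec Bool m) → hookCount (suc s) (doubled (parts ε)) ≡ descents s (path ε)
  hookCount-doubled s []          = refl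
  hookCount-doubled s (false ∷ ε) = trans (hookCount-doubled s ε) (sym (descents-∷ʳ-true s (path ε)))
  hookCount-doubled s (true  ∷ ε) =
    trans (cong (hookCount (suc s)) (sym (rows-path (true ∷ ε)))) (hookCount-rows s (path (true ∷ ε)))

  sum-map-suc : ∀ xs → sum (map suc xs) ≡ length xs + sum xs
  sum-map-suc []       = refl
  sum-map-suc (x ∷ xs) = cong suc (trans (cong (x +_) (sum-map-suc xs)) (swap x (length xs) (sum xs)))
    where
    swap : ∀ a b c → a + (b + c) ≡ b + (a + c)
    swap = ℕ-Solver.solve-∀

  length-rows-path : ∀ {m} (ε : Vec Bool m) → length (rows (path ε)) ≡ m
  length-rows-path []          = refl
  length-rows-path (false ∷ ε) = trans (cong length (rows-∷ʳ-true (path ε)))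
    (trans (length-++ (rows (path ε))) (trans (ℕ.+-comm _ 1) (cong suc (length-rows-path ε))))
  length-rows-path (true  ∷ ε) = cong suc (trans (cong length (rows-∷ʳ-false (path ε)))
    (trans (length-map suc (rows (path ε))) (length-rows-path ε)))

  sum-rows-path : ∀ {m} (ε : Vec Bool m) → sum (rows (path ε)) ≡ 2 * sum (parts ε)
  sum-rows-path []          = refl
  sum-rows-path (false ∷ ε) = trans (cong sum (rows-∷ʳ-true (path ε)))
    (trans (sum-++ (rows (path ε)) (0 ∷ [])) (trans (ℕ.+-identityʳ _) (sum-rows-path ε)))
  sum-rows-path {suc m} (true ∷ ε) = begin
    zeros (path ε ∷ʳ false) + sum (rows (path ε ∷ʳ false))
      ≡⟨ cong₂ _+_ (trans (zeros-∷ʳ-false (path ε)) (cong suc (zeros-path ε)))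
           (trans (cong sum (rows-∷ʳ-false (path ε))) (sum-map-suc (rows (path ε)))) ⟩
    suc (suc m) + (length (rows (path ε)) + sum (rows (path ε)))
      ≡⟨ cong (suc (suc m) +_) (cong₂ _+_ (length-rows-path ε) (sum-rows-path ε)) ⟩
    suc (suc m) + (m + 2 * sum (parts ε))
      ≡⟨ double m (sum (parts ε)) ⟩
    2 * (suc m + sum (parts ε)) ∎
    where
    open ≡.≡-Reasoning
    double : ∀ m k → suc (suc m) + (m + 2 * k) ≡ 2 * (suc m + k)
    double = ℕ-Solver.solve-∀

  size-doubled : ∀ {m} (ε : Vec Bool m) → sum (doubled (parts ε)) ≡ 2 * sum (parts ε)
  size-doubled []          = refl
  size-doubled (false ∷ ε) = size-doubled ε
  size-doubled (true  ∷ ε) = trans (cong sum (sym (rows-path (true ∷ ε)))) (sum-rows-path (true ∷ ε))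

  at-∷ʳ : ∀ i W b → i < length W → at i (W ∷ʳ b) ≡ at i W
  at-∷ʳ zero    (_ ∷ W) b _       = refl
  at-∷ʳ (suc i) (_ ∷ W) b (s≤s p) = at-∷ʳ i W b p

  at-last : ∀ W b → at (length W) (W ∷ʳ b) ≡ just b
  at-last []      b = refl
  at-last (_ ∷ W) b = at-last W b

  at-beyond : ∀ i W → length W ≤ i → at i W ≡ nothing
  at-beyond i       []      _       = refl
  at-beyond (suc i) (_ ∷ W) (s≤s p) = at-beyond i W p

  descents-short : ∀ s W → length W ≤ suc s → descents s W ≡ 0
  descents-short s []          _       = refl
  descents-short s (true  ∷ W) (s≤s p) =
    cong₂ _+_ (cong isFalse (at-beyond s W p)) (descents-short s W (ℕ.m≤n⇒m≤1+n p))
  descents-short s (false ∷ W) (s≤s p) = descents-short s W (ℕ.m≤n⇒m≤1+n p)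

  -- The appended entry has index s + 1 + i, so its only partner at distance s + 1 before it is the
  -- entry with index i.
  descents-∷ʳ-false : ∀ s i W → length W ≡ suc s + i →
                      descents s (W ∷ʳ false) ≡ isTrue (at i W) + descents s W
  descents-∷ʳ-false s zero (b ∷ W) e = go b
    where
    len : length W ≡ s
    len = trans (ℕ.suc-injective e) (ℕ.+-identityʳ s)
    short : descents s (W ∷ʳ false) ≡ descents s W
    short = trans
      (descents-short s (W ∷ʳ false)
        (ℕ.≤-reflexive (trans (length-++ W) (trans (ℕ.+-comm _ 1) (cong suc len)))))
      (sym (descents-short s W (ℕ.m≤n⇒m≤1+n (ℕ.≤-reflexive len))))
    go : ∀ b → descents s (b ∷ W ∷ʳ false) ≡ isTrue (just b) + descents s (b ∷ W)
    go false = short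
    go true  = cong₂ _+_
      (cong isFalse (trans (cong (λ k → at k (W ∷ʳ false)) (sym len)) (at-last W false)))
      (trans short (sym (cong (_+ descents s W)
        (cong isFalse (at-beyond s W (ℕ.≤-reflexive len))))))
  descents-∷ʳ-false s (suc i) (b ∷ W) e = go b
    where
    len : length W ≡ suc s + i
    len = trans (ℕ.suc-injective e) (ℕ.+-suc s i)
    ih = descents-∷ʳ-false s i W len
    swap : ∀ a b c → a + (b + c) ≡ b + (a + c)
    swap = ℕ-Solver.solve-∀
    go : ∀ b → descents s (b ∷ W ∷ʳ false) ≡ isTrue (at i W) + descents s (b ∷ W)
    go false = ih
    go true  = trans
      (cong₂ _+_ (cong isFalse (at-∷ʳ s W false (subst (s <_) (sym len) (ℕ.m≤m+n (suc s) i)))) ih)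
      (swap (isFalse (at s W)) (isTrue (at i W)) (descents s W))

  -- Index i of the path is place m - i: the upper half holds the bits, index m is place 0, and the
  -- lower half holds the complements.
  at-path-upper : ∀ {m} (ε : Vec Bool m) i j → i + j ≡ m → 1 ≤ j → at i (path ε) ≡ just (bit j ε)
  at-path-upper []              zero    .zero refl ()
  at-path-upper (b ∷ ε)       zero    j e _ rewrite e = cong just (sym (bit-top b ε))
  at-path-upper (_∷_ {m} b ε) (suc i) j e 1≤j = trans
    (at-∷ʳ i (path ε) (not b) (subst (i <_) (sym (length-path ε)) (s≤s (ℕ.≤-trans i≤m (ℕ.m≤m+n m m)))))
    (trans (at-path-upper ε i j e′ 1≤j) (cong just (sym (bit-below b ε (ℕ.m+n≤o⇒n≤o i (ℕ.≤-reflexive e′))))))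
    where
    e′ = ℕ.suc-injective e
    i≤m = ℕ.m+n≤o⇒m≤o i (ℕ.≤-reflexive e′)

  at-path-middle : ∀ {m} (ε : Vec Bool m) → at m (path ε) ≡ just false
  at-path-middle []              = refl
  at-path-middle (_∷_ {m} b ε) = trans
    (at-∷ʳ m (path ε) (not b) (subst (m <_) (sym (length-path ε)) (s≤s (ℕ.m≤m+n m m))))
    (at-path-middle ε)

  at-path-lower : ∀ {m} (ε : Vec Bool m) j → 1 ≤ j → j ≤ m → at (m + j) (path ε) ≡ just (not (bit j ε))
  at-path-lower [] _ (s≤s _) ()
  at-path-lower (_∷_ {m} b ε) j 1≤j j≤1+m with j ≟ suc m
  ... | yes refl = trans (cong (λ k → at k (path ε ∷ʳ not b)) (trans (ℕ.+-suc m m) (sym (length-path ε))))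
                     (trans (at-last (path ε) (not b)) (cong (just ∘ not) (sym (bit-top b ε))))
  ... | no j≢ = trans
    (at-∷ʳ (m + j) (path ε) (not b) (subst (m + j <_) (sym (length-path ε)) (s≤s (ℕ.+-monoʳ-≤ m j≤m))))
    (trans (at-path-lower ε j 1≤j j≤m) (cong (just ∘ not) (sym (bit-below b ε j≤m))))
    where j≤m = ℕ.≤-pred (ℕ.≤∧≢⇒< j≤1+m j≢)

  private
    -- With a = m + 1 and t = s + 1, index s is place a - t, the partner of the new 1 at place a.
    -- Index i is place t - a, the partner of the new 0 at place -a.
    new-part : ∀ {m} s (ε : Vec Bool m) i → suc (m + m) ≡ suc s + i →
      descents s (path (true ∷ ε)) ≡ isFalse (at s (path ε)) + isTrue (at i (path ε)) + descents s (path ε)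
    new-part {m} s ε i e = trans
      (cong₂ _+_ (cong isFalse (at-∷ʳ s (path ε) false (subst (s <_) (sym len) (ℕ.m≤m+n (suc s) i))))
        (descents-∷ʳ-false s i (path ε) len))
      (sym (ℕ.+-assoc (isFalse (at s (path ε))) _ _))
      where len = trans (length-path ε) e

  twice : Bool → ℕ
  twice false = 0
  twice true  = 2

  isFalse-isTrue : ∀ b c → b ≡ c → isFalse (just b) + isTrue (just (not c)) ≡ twice (not b)
  isFalse-isTrue true  _ refl = refl
  isFalse-isTrue false _ refl = refl

  -- For a new largest part a = m + 1 and t = s + 1, the cases a > t, a = t,
  -- t/2 < a < t, a = t/2 and a < t/2.

  descents-above : ∀ {m} s c (ε : Vec Bool m) → m ≡ s + c → 1 ≤ c →
                   descents s (path (true ∷ ε)) ≡ twice (not (bit c ε)) + descents s (path ε)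
  descents-above {m} s c ε refl 1≤c = trans (new-part s ε (m + c) (split s c))
    (cong (_+ descents s (path ε))
      (trans (cong₂ (λ a b → isFalse a + isTrue b) (at-path-upper ε s c refl 1≤c)
               (at-path-lower ε c 1≤c (ℕ.m≤n+m c s)))
        (isFalse-isTrue (bit c ε) _ refl)))
    where
    split : ∀ s c → suc (s + c + (s + c)) ≡ suc s + (s + c + c)
    split = ℕ-Solver.solve-∀

  descents-equal : ∀ {m} (ε : Vec Bool m) → descents m (path (true ∷ ε)) ≡ 1 + descents m (path ε)
  descents-equal {m} ε = trans (new-part m ε m refl)
    (cong (_+ descents m (path ε)) (cong (λ a → isFalse a + isTrue a) (at-path-middle ε)))

  descents-between : ∀ {m} s c (ε : Vec Bool m) → s ≡ m + c → 1 ≤ c → c ≤ m →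
                     descents s (path (true ∷ ε)) ≡ twice (bit c ε) + descents s (path ε)
  descents-between {m} s c ε refl 1≤c c≤m = trans (new-part s ε (m ∸ c) split)
    (cong (_+ descents s (path ε))
      (trans (cong₂ (λ a b → isFalse a + isTrue b) (at-path-lower ε c 1≤c c≤m)
               (at-path-upper ε (m ∸ c) c (ℕ.m∸n+n≡m c≤m) 1≤c))
        (go (bit c ε))))
    where
    split : suc (m + m) ≡ suc (m + c) + (m ∸ c)
    split = cong suc (trans (cong (m +_) (sym (ℕ.m+[n∸m]≡n c≤m))) (sym (ℕ.+-assoc m c _)))
    go : ∀ b → isFalse (just (not b)) + isTrue (just b) ≡ twice b
    go true  = refl
    go false = refl

  -- Here t = 2a, and the new 1 and the new 0 are partners of each other; the old path is too short
  -- to contain a pair at distance t.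
  descents-half : ∀ {m} (ε : Vec Bool m) →
                  descents (suc (m + m)) (path (true ∷ ε)) ≡ 1 + descents (suc (m + m)) (path ε)
  descents-half {m} ε = cong₂ _+_
    (cong isFalse (trans (cong (λ k → at k (path ε ∷ʳ false)) (sym (length-path ε))) (at-last (path ε) false)))
    (trans (descents-short _ (path ε ∷ʳ false)
             (ℕ.≤-reflexive (trans (length-++ (path ε)) (trans (ℕ.+-comm _ 1) (cong suc (length-path ε))))))
      (sym (descents-short _ (path ε) (ℕ.m≤n⇒m≤1+n (ℕ.≤-reflexive (length-path ε))))))

  descents-below : ∀ {m} s (ε : Vec Bool m) → suc (m + m) < s →
                   descents s (path (true ∷ ε)) ≡ 0 + descents s (path ε)
  descents-below {m} s ε p = trans
    (descents-short s (path (true ∷ ε)) (s≤s (ℕ.≤-trans (ℕ.≤-reflexive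
      (trans (length-++ (path ε)) (trans (ℕ.+-comm _ 1) (cong suc (length-path ε))))) p)))
    (sym (descents-short s (path ε) (subst (_≤ suc s) (sym (length-path ε)) (ℕ.m≤n⇒m≤1+n (ℕ.<⇒≤ p)))))

open Hooks

-- Sums over bit vectors and elimination of the largest bit

module BitSums {c ℓ} (S : CommutativeRing c ℓ) where
  open CommutativeRing S
  open IntegerSolver S

  ∑ : ∀ m → (Vec Bool m → Carrier) → Carrier
  ∑ zero    φ = φ []
  ∑ (suc m) φ = ∑ m (φ ∘ (false ∷_)) + ∑ m (φ ∘ (true ∷_))

  ∑-cong : ∀ m {φ ψ} → (∀ ε → φ ε ≈ ψ ε) → ∑ m φ ≈ ∑ m ψ
  ∑-cong zero    e = e []
  ∑-cong (suc m) e = +-cong (∑-cong m (e ∘ (false ∷_))) (∑-cong m (e ∘ (true ∷_)))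

  ∑-+ : ∀ m φ ψ → ∑ m φ + ∑ m ψ ≈ ∑ m (λ ε → φ ε + ψ ε)
  ∑-+ zero    φ ψ = refl
  ∑-+ (suc m) φ ψ = trans
    (solve 4 (λ a b c d → (a :+ b) :+ (c :+ d) := (a :+ c) :+ (b :+ d)) refl _ _ _ _)
    (+-cong (∑-+ m _ _) (∑-+ m _ _))

  ∑-*ˡ : ∀ m a φ → ∑ m (λ ε → a * φ ε) ≈ a * ∑ m φ
  ∑-*ˡ zero    a φ = refl
  ∑-*ˡ (suc m) a φ = trans (+-cong (∑-*ˡ m a _) (∑-*ˡ m a _)) (sym (distribˡ a _ _))

  ∏ : ∀ {m} → (ℕ → Bool → Carrier) → Vec Bool m → Carrier
  ∏ τ []                = 1#
  ∏ τ (_∷_ {m} b ε) = τ (suc m) b * ∏ τ ε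

  ∏-cong : ∀ {m τ τ′} (ε : Vec Bool m) →
           (∀ j → 1 ≤ j → j ≤ m → ∀ b → τ j b ≈ τ′ j b) → ∏ τ ε ≈ ∏ τ′ ε
  ∏-cong []      e = refl
  ∏-cong (b ∷ ε) e = *-cong (e _ (s≤s z≤n) ℕ.≤-refl b)
    (∏-cong ε λ j 1≤j j≤m → e j 1≤j (ℕ.m≤n⇒m≤1+n j≤m))

  -- A factor depending on a single bit can be absorbed into the table τ; this is how the message of
  -- an eliminated bit is passed down.
  ∏-update : ∀ {m τ τ′} c (g : Bool → Carrier) (ε : Vec Bool m) → 1 ≤ c → c ≤ m →
             (∀ b → τ′ c b ≈ g b * τ c b) →
             (∀ j → 1 ≤ j → j ≤ m → j ≢ c → ∀ b → τ′ j b ≈ τ j b) →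
             ∏ τ′ ε ≈ g (bit c ε) * ∏ τ ε
  ∏-update c g [] (s≤s _) ()
  ∏-update {suc m} {τ} {τ′} c g (b ∷ ε) 1≤c c≤1+m at-c off-c with c ≟ suc m
  ... | yes ≡.refl = trans
        (*-cong (at-c b) (∏-cong ε λ j 1≤j j≤m → off-c j 1≤j (ℕ.m≤n⇒m≤1+n j≤m) (ℕ.<⇒≢ (s≤s j≤m))))
        (trans (*-assoc _ _ _) (*-congʳ (reflexive (≡.cong g (≡.sym (bit-top b ε))))))
  ... | no c≢ = trans
        (*-cong (off-c (suc m) (s≤s z≤n) ℕ.≤-refl (c≢ ∘ ≡.sym) b)
          (∏-update c g ε 1≤c c≤m at-c λ j 1≤j j≤m → off-c j 1≤j (ℕ.m≤n⇒m≤1+n j≤m)))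
        (trans (solve 3 (λ x y z → x :* (y :* z) := y :* (x :* z)) refl _ _ _)
          (*-congʳ (reflexive (≡.cong g (≡.sym (bit-below b ε c≤m))))))
    where c≤m = ℕ.≤-pred (ℕ.≤∧≢⇒< c≤1+m c≢)

module Elimination {c ℓ} (S : CommutativeRing c ℓ) (s : ℕ) (x u : CommutativeRing.Carrier S) where
  open CommutativeRing S
  open Pochhammer S
  open BitSums S
  open IntegerSolver S
  open import Relation.Binary.Reasoning.Setoid setoid

  weight : ∀ {m} → Vec Bool m → Carrier
  weight ε = x ^ descents s (path ε) * u ^ sum (parts ε)

  weight-false : ∀ {m} (ε : Vec Bool m) → weight (false ∷ ε) ≈ weight ε
  weight-false ε = *-congʳ (^-congʳ x (descents-∷ʳ-true s (path ε)))

  weight-true : ∀ {m} d (ε : Vec Bool m) → descents s (path (true ∷ ε)) ≡ d ℕ.+ descents s (path ε) →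
                weight (true ∷ ε) ≈ x ^ d * u ^ suc m * weight ε
  weight-true {m} d ε e = trans
    (*-cong (trans (^-congʳ x e) (^-homo-* x d _)) (^-homo-* u (suc m) (sum (parts ε))))
    (solve 4 (λ a b c d → a :* b :* (c :* d) := a :* c :* (b :* d)) refl _ _ _ _)

  weighted : ∀ m → (ℕ → Bool → Carrier) → Carrier
  weighted m τ = ∑ m (λ ε → weight ε * ∏ τ ε)

  weighted-cong : ∀ m {τ τ′} → (∀ j → 1 ≤ j → j ≤ m → ∀ b → τ j b ≈ τ′ j b) →
                  weighted m τ ≈ weighted m τ′
  weighted-cong m e = ∑-cong m (λ ε → *-congˡ (∏-cong ε e))

  -- The bit at a summed out, when setting it creates d hooks.
  message : (ℕ → Bool → Carrier) → ℕ → ℕ → Carrier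
  message τ a d = τ a false + x ^ d * u ^ a * τ a true

  message-cong : ∀ τ τ′ a d → (∀ b → τ a b ≈ τ′ a b) → message τ a d ≈ message τ′ a d
  message-cong τ τ′ a d e = +-cong (e false) (*-congˡ (e true))

  private
    sum-top : ∀ {m} τ d (ε : Vec Bool m) → descents s (path (true ∷ ε)) ≡ d ℕ.+ descents s (path ε) →
              weight (false ∷ ε) * ∏ τ (false ∷ ε) + weight (true ∷ ε) * ∏ τ (true ∷ ε)
              ≈ message τ (suc m) d * (weight ε * ∏ τ ε)
    sum-top τ d ε e = trans (+-cong (*-congʳ (weight-false ε)) (*-congʳ (weight-true d ε e)))
      (solve 5 (λ w f k t p → w :* (f :* p) :+ (k :* w) :* (t :* p) := (f :+ k :* t) :* (w :* p))
        refl _ _ _ _ _)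

  eliminate-root : ∀ m τ d →
    (∀ (ε : Vec Bool m) → descents s (path (true ∷ ε)) ≡ d ℕ.+ descents s (path ε)) →
    weighted (suc m) τ ≈ message τ (suc m) d * weighted m τ
  eliminate-root m τ d e = trans (∑-+ m _ _)
    (trans (∑-cong m (λ ε → sum-top τ d ε (e ε))) (∑-*ˡ m (message τ (suc m) d) _))

  -- The hooks created by the top part depend on bit k alone, so summing out the top bit leaves a
  -- function of bit k, which changes τ at k only.
  eliminate-child : ∀ m τ τ′ k (d : Bool → ℕ) → 1 ≤ k → k ≤ m →
    (∀ (ε : Vec Bool m) → descents s (path (true ∷ ε)) ≡ d (bit k ε) ℕ.+ descents s (path ε)) →
    (∀ b → τ′ k b ≈ message τ (suc m) (d b) * τ k b) →
    (∀ j → 1 ≤ j → j ≤ m → j ≢ k → ∀ b → τ′ j b ≈ τ j b) →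
    weighted (suc m) τ ≈ weighted m τ′
  eliminate-child m τ τ′ k d 1≤k k≤m e at-k off-k = trans (∑-+ m _ _) (∑-cong m λ ε → trans
    (sum-top τ (d (bit k ε)) ε (e ε))
    (trans (solve 3 (λ a b c → a :* (b :* c) := b :* (a :* c)) refl _ _ _)
      (*-congˡ (sym (∏-update k (message τ (suc m) ∘ d) ε 1≤k k≤m at-k off-k)))))

-- Factorization over the residues mod t

module RunnerProduct {c ℓ} (S : CommutativeRing c ℓ) (s N : ℕ) (u : CommutativeRing.Carrier S)
  (uᴺ≈0 : CommutativeRing._≈_ S (Pochhammer._^_ S u N) (CommutativeRing.0# S)) where
  open CommutativeRing S
  open Pochhammer S
  open BitSums S
  open IntegerSolver S
  open import Algebra.Properties.Ring ring using (-‿distribˡ-*; -0#≈0#)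
  open import Relation.Binary.Reasoning.Setoid setoid

  t : ℕ
  t = suc s

  Q : Carrier
  Q = u ^ t

  u-vanish : ∀ {n} → N ≤ n → u ^ n ≈ 0#
  u-vanish {n} N≤n = begin
    u ^ n                   ≡⟨ ≡.cong (u ^_) (ℕ.m+[n∸m]≡n N≤n) ⟨
    u ^ (N ℕ.+ (n ∸ N))     ≈⟨ ^-homo-* u N (n ∸ N) ⟩
    u ^ N * u ^ (n ∸ N)     ≈⟨ trans (*-congʳ uᴺ≈0) (zeroˡ _) ⟩
    0#                      ∎

  power-vanish : ∀ k → (u ^ suc k) ^ N ≈ 0#
  power-vanish k = trans (^-assocʳ u (suc k) N) (u-vanish (ℕ.m≤m+n N _))

  open Runner S Q N (power-vanish s) public

  product : ℕ → (ℕ → Carrier) → Carrier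
  product zero    g = 1#
  product (suc m) g = g (suc m) * product m g

  product-cong : ∀ m {g g′} → (∀ j → 1 ≤ j → j ≤ m → g j ≈ g′ j) → product m g ≈ product m g′
  product-cong zero    e = refl
  product-cong (suc m) e = *-cong (e (suc m) (s≤s z≤n) ℕ.≤-refl)
    (product-cong m λ j 1≤j j≤m → e j 1≤j (ℕ.m≤n⇒m≤1+n j≤m))

  product-*ˡ : ∀ m a g → product m (λ j → a * g j) ≈ a ^ m * product m g
  product-*ˡ zero    a g = sym (*-identityˡ 1#)
  product-*ˡ (suc m) a g = trans (*-congˡ (product-*ˡ m a g))
    (solve 4 (λ a b c d → a :* b :* (c :* d) := a :* c :* (b :* d)) refl _ _ _ _)

  pairs : ℕ → Carrier → Carrier
  pairs h w = product h (λ j → 𝒢 (u ^ j) (u ^ (t ∸ j)) w)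

  pairs-cong : ∀ h {w w′} → w ≈ w′ → pairs h w ≈ pairs h w′
  pairs-cong h w≈ = product-cong h (λ _ _ _ → 𝒢-cong refl refl w≈)

  pairs-limit : ∀ h → h ≤ t → ∀ w → pairs h w ≈ poch (Q * w) Q N ^ h * pairs h 0#
  pairs-limit h h≤t w = trans
    (product-cong h λ j _ j≤h → poch-limit (𝒢 (u ^ j) (u ^ (t ∸ j))) (𝒢-cong refl refl) Q Q
      (λ v → 𝒢-shift (u ^ j) (u ^ (t ∸ j)) v
        (trans (sym (^-homo-* u j (t ∸ j))) (^-congʳ u (ℕ.m+[n∸m]≡n (ℕ.≤-trans j≤h h≤t)))))
      N (power-vanish s) w)
    (product-*ˡ h _ _)

  -- Generating function of the runner of a residue a with a ≡ -a mod t.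
  fixed : Carrier → ℕ → Carrier → Carrier
  fixed x a w = 𝒜 (u ^ a * Q) w + x * (u ^ a * ℬ (u ^ a * Q) w)

  -- This value at x = 1 is the very constant left over in `fixed-𝒟` (a = t) and in `fixed-ℋ` (a =
  -- t/2), so it is identified without being computed.
  fixed-one : ∀ a → fixed 1# a 0# ≈ 𝒜 (u ^ a) 0#
  fixed-one a = begin
    𝒜 (u ^ a * Q) 0# + 1# * (u ^ a * ℬ (u ^ a * Q) 0#)  ≈⟨ +-congˡ (*-identityˡ _) ⟩
    𝒜 (u ^ a * Q) 0# + u ^ a * ℬ (u ^ a * Q) 0#         ≈⟨ ℬ-rec (u ^ a) 0# ⟨
    ℬ (u ^ a) 0#                                        ≈⟨ 𝒜-shift (u ^ a) 0# ⟨
    𝒜 (u ^ a) (0# * Q)                                  ≈⟨ 𝒜-cong refl (zeroˡ Q) ⟩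
    𝒜 (u ^ a) 0#                                        ∎

  -- D*(x; q^t) with N factors in each product: e is the inverse of 1 + x, w is 1 - x², Q is q^(2t).
  𝒟 : Carrier → Carrier → Carrier → Carrier
  𝒟 x e w = e * (poch (Q * w) (Q * Q) N + x * poch (Q * (w * Q)) (Q * Q) N)

  -- Up to the eigenvalue 1 + x the runner of residue 0 is 𝒜(Q,w) + x ℬ(Q,w), and ℬ(Q,w) = 𝒜(Q,wQ).
  -- The two products of D* are thus one solution evaluated at w and at wQ.
  fixed-𝒟 : ∀ x e w → (1# + x) * e ≈ 1# → x * x ≈ 1# - w →
            fixed x t w ≈ 𝒟 x e w * 𝒜 Q 0#
  fixed-𝒟 x e w inv x² = begin
    fixed x t w
      ≈⟨ trans (*-congʳ inv) (*-identityˡ _) ⟨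
    (1# + x) * e * fixed x t w
      ≈⟨ solve 3 (λ a b c → a :* b :* c := b :* (a :* c)) refl _ _ _ ⟩
    e * ((1# + x) * fixed x t w)
      ≈⟨ *-congˡ (𝒜+xℬ x Q w x²) ⟨
    e * (𝒜 Q w + x * ℬ Q w)
      ≈⟨ *-congˡ (+-cong (limit w) (*-congˡ (trans (sym (𝒜-shift Q w)) (limit (w * Q))))) ⟩
    e * (poch (Q * w) (Q * Q) N * 𝒜 Q 0# + x * (poch (Q * (w * Q)) (Q * Q) N * 𝒜 Q 0#))
      ≈⟨ solve 5 (λ e a x b y → e :* (a :* y :+ x :* (b :* y)) := e :* (a :+ x :* b) :* y) refl _ _ _ _ _ ⟩
    𝒟 x e w * 𝒜 Q 0# ∎
    where
    limit : ∀ v → 𝒜 Q v ≈ poch (Q * v) (Q * Q) N * 𝒜 Q 0#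
    limit = poch-limit (𝒜 Q) (𝒜-cong refl) Q (Q * Q) 𝒜-one N
      (trans (^-distrib-* Q Q N) (trans (*-congˡ (power-vanish s)) (zeroʳ _)))

  ℋ : Carrier → Carrier → Carrier → Carrier → Carrier
  ℋ e σ r p = e * ((1# - σ) * poch (- r) (- p) N + (1# + σ) * poch r (- p) N)

  fixed-ℋ : ∀ h → suc h ℕ.+ suc h ≡ t → ∀ x e w e′ σ r →
            (1# + x) * e ≈ 1# → (1# + 1#) * x * e′ ≈ 1# → x * x ≈ 1# - w → r * r ≈ w → r ≈ (1# + x) * σ →
            fixed x (suc h) w ≈ ℋ e′ σ r (u ^ suc h) * 𝒜 (u ^ suc h) 0#
  fixed-ℋ h 2h≡t x e w e′ σ r inv inv′ x² r² r≈ = begin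
    f
      ≈⟨ trans (*-cong (trans (*-cong inv inv′) (*-identityˡ 1#)) refl) (*-identityˡ f) ⟨
    ((1# + x) * e) * ((1# + 1#) * x * e′) * f
      ≈⟨ solve 5 (λ a b c d f → (a :* b) :* (c :* d) :* f := (b :* d) :* (c :* (a :* f))) refl _ _ _ _ _ ⟩
    (e * e′) * ((1# + 1#) * x * ((1# + x) * f))
      ≈⟨ *-congˡ (*-congˡ (sym (𝒜+xℬ x p w x²))) ⟩
    (e * e′) * ((1# + 1#) * x * (𝒜 p w + x * ℬ p w))
      ≈⟨ *-congˡ (Y-sum x r w x² r²) ⟩
    (e * e′) * ((1# + x - r) * Y (- r) + (1# + x + r) * Y r)
      ≈⟨ *-congˡ (+-cong (*-cong (+-congˡ (-‿cong r≈)) (limit (- r))) (*-cong (+-congˡ r≈) (limit r))) ⟩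
    (e * e′) * ((1# + x - (1# + x) * σ) * (poch (- r) (- p) N * y)
                + (1# + x + (1# + x) * σ) * (poch r (- p) N * y))
      ≈⟨ solve 7 (λ e e′ x σ a b y →
           (e :* e′) :* ((:1 :+ x :- (:1 :+ x) :* σ) :* (a :* y) :+ (:1 :+ x :+ (:1 :+ x) :* σ) :* (b :* y))
           := ((:1 :+ x) :* e) :* (e′ :* ((:1 :- σ) :* a :+ (:1 :+ σ) :* b) :* y)) refl _ _ _ _ _ _ _ ⟩
    ((1# + x) * e) * (ℋ e′ σ r p * y)
      ≈⟨ trans (*-congʳ inv) (*-identityˡ _) ⟩
    ℋ e′ σ r p * y ∎
    where
    p = u ^ suc h
    f = fixed x (suc h) w
    y = 𝒜 p 0#
    open SelfPaired p (trans (sym (^-homo-* u (suc h) (suc h))) (^-congʳ u 2h≡t))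
    -p-vanish : (- p) ^ N ≈ 0#
    -p-vanish = trans (^-congˡ N (trans (-‿cong (sym (*-identityˡ p))) (-‿distribˡ-* 1# p)))
      (trans (^-distrib-* (- 1#) p N) (trans (*-congˡ (power-vanish h)) (zeroʳ _)))
    limit : ∀ v → Y v ≈ poch v (- p) N * y
    limit v = trans (poch-limit Y Y-cong 1# (- p) Y-step N -p-vanish v)
      (*-cong (poch-cong N (*-identityˡ v) refl) Y-zero)

  module _ (x : Carrier) where
    open Elimination S s x u public

    private
      w : Carrier
      w = 1# - x * x

    runner : ℕ → Bool → Carrier
    runner j false = 𝒜 (u ^ (j ℕ.+ t)) w
    runner j true  = ℬ (u ^ (j ℕ.+ t)) w

    runner-one : ∀ {j} → N ≤ j → ∀ b → runner j b ≈ 1#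
    runner-one N≤j false = 𝒜-zero w (u-vanish (ℕ.≤-trans N≤j (ℕ.m≤m+n _ t)))
    runner-one N≤j true  = ℬ-zero w (u-vanish (ℕ.≤-trans N≤j (ℕ.m≤m+n _ t)))

    runner-rec : ∀ j b → runner j b ≈ message runner (j ℕ.+ t) (twice (not b))
    runner-rec j false = trans (𝒜-rec (u ^ (j ℕ.+ t)) w) (+-cong
      (𝒜-cong (sym (^-homo-* u (j ℕ.+ t) t)) refl)
      (trans (sym (*-assoc _ _ _)) (*-cong
        (*-congʳ (solve 1 (λ x → :1 :- (:1 :- x :* x) := x :* (x :* :1)) refl x))
        (ℬ-cong (sym (^-homo-* u (j ℕ.+ t) t)) refl))))
    runner-rec j true = trans (ℬ-rec (u ^ (j ℕ.+ t)) w) (+-cong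
      (𝒜-cong (sym (^-homo-* u (j ℕ.+ t) t)) refl)
      (*-cong (sym (*-identityˡ _)) (ℬ-cong (sym (^-homo-* u (j ℕ.+ t) t)) refl)))

    -- Messages of the parts above t + k have been passed down.
    above : ℕ → ℕ → Bool → Carrier
    above k j b = if does (j ≤? k) then 1# else runner j b

    above-≤ : ∀ k {j} → j ≤ k → ∀ b → above k j b ≈ 1#
    above-≤ k {j} j≤k b = reflexive (≡.cong (λ d → if d then 1# else runner j b) (dec-true (j ≤? k) j≤k))

    above-≰ : ∀ k {j} → ¬ (j ≤ k) → ∀ b → above k j b ≈ runner j b
    above-≰ k {j} j≰k b = reflexive (≡.cong (λ d → if d then 1# else runner j b) (dec-false (j ≤? k) j≰k))

    eliminate-above : ∀ k → weighted (suc (s ℕ.+ k)) (above k) ≈ weighted (suc s) runner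
    eliminate-above zero = trans (reflexive (≡.cong (λ m → weighted (suc m) (above 0)) (ℕ.+-identityʳ s)))
      (weighted-cong (suc s) λ j 1≤j _ → above-≰ 0 (ℕ.<⇒≱ 1≤j))
    eliminate-above (suc k) = begin
      weighted (suc (s ℕ.+ suc k)) (above (suc k))
        ≈⟨ eliminate-child (s ℕ.+ suc k) (above (suc k)) (above k) (suc k) (twice ∘ not)
             (s≤s z≤n) (ℕ.m≤n+m (suc k) s)
             (λ ε → descents-above s (suc k) ε ≡.refl (s≤s z≤n)) at-k off-k ⟩
      weighted (s ℕ.+ suc k) (above k)
        ≡⟨ ≡.cong (λ m → weighted m (above k)) (ℕ.+-suc s k) ⟩
      weighted (suc (s ℕ.+ k)) (above k)
        ≈⟨ eliminate-above k ⟩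
      weighted (suc s) runner ∎
      where
      a = suc (s ℕ.+ suc k)
      at-k : ∀ b → above k (suc k) b ≈ message (above (suc k)) a (twice (not b)) * above (suc k) (suc k) b
      at-k b = begin
        above k (suc k) b
          ≈⟨ above-≰ k (ℕ.<⇒≱ ℕ.≤-refl) b ⟩
        runner (suc k) b
          ≈⟨ runner-rec (suc k) b ⟩
        message runner (suc k ℕ.+ t) (twice (not b))
          ≡⟨ ≡.cong (λ a → message runner a (twice (not b))) (ℕ.+-comm (suc k) t) ⟩
        message runner a (twice (not b))
          ≈⟨ message-cong (above (suc k)) runner a (twice (not b)) (above-≰ (suc k) (ℕ.<⇒≱ (s≤s (ℕ.m≤n+m (suc k) s)))) ⟨
        message (above (suc k)) a (twice (not b))
          ≈⟨ trans (*-congˡ (above-≤ (suc k) ℕ.≤-refl b)) (*-identityʳ _) ⟨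
        message (above (suc k)) a (twice (not b)) * above (suc k) (suc k) b ∎
      off-k : ∀ j → 1 ≤ j → j ≤ s ℕ.+ suc k → j ≢ suc k → ∀ b → above k j b ≈ above (suc k) j b
      off-k j _ _ j≢ b with j ≤? k
      ... | yes j≤k = trans (above-≤ k j≤k b) (sym (above-≤ (suc k) (ℕ.m≤n⇒m≤1+n j≤k) b))
      ... | no j≰k  = trans (above-≰ k j≰k b)
              (sym (above-≰ (suc k) (λ j≤1+k → j≰k (ℕ.≤-pred (ℕ.≤∧≢⇒< j≤1+k j≢))) b))

    total : ℕ → Carrier
    total m = ∑ m weight

    total-above : total (suc (s ℕ.+ N)) ≈ weighted (suc s) runner
    total-above = trans
      (∑-cong (suc (s ℕ.+ N)) {weight} λ ε → trans (sym (*-identityʳ _)) (*-congˡ (sym (ones ε))))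
      (trans (weighted-cong (suc (s ℕ.+ N)) {λ _ _ → 1#} (λ j _ _ → one j)) (eliminate-above N))
      where
      ones : ∀ {m} (ε : Vec Bool m) → ∏ (λ _ _ → 1#) ε ≈ 1#
      ones []      = refl
      ones (b ∷ ε) = trans (*-identityˡ _) (ones ε)
      one : ∀ j b → 1# ≈ above N j b
      one j b with j ≤? N
      ... | yes j≤N = sym (above-≤ N j≤N b)
      ... | no j≰N  = sym (trans (above-≰ N j≰N b) (runner-one (ℕ.≰⇒≥ j≰N) b))

    message-fixed : ∀ a → message runner a 1 ≈ fixed x a w
    message-fixed a = +-cong (𝒜-cong (^-homo-* u a t) refl)
      (trans (*-congˡ (ℬ-cong (^-homo-* u a t) refl))
        (solve 3 (λ x a b → x :* :1 :* a :* b := x :* (a :* b)) refl _ _ _))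

    eliminate-t : weighted (suc s) runner ≈ fixed x t w * weighted s runner
    eliminate-t = trans (eliminate-root s runner 1 descents-equal) (*-congʳ (message-fixed t))

    paired : ℕ → Bool → Carrier
    paired j b = message runner (t ∸ j) (twice b) * runner j b

    module _ (h h′ : ℕ) (s≡ : s ≡ h′ ℕ.+ h) (h≤h′ : h ≤ h′) where

      -- Messages of the parts above h′ + k have been passed down.
      between : ℕ → ℕ → Bool → Carrier
      between k j b = if does (j ℕ.+ k ≤? h) then paired j b else runner j b

      between-≤ : ∀ k {j} → j ℕ.+ k ≤ h → ∀ b → between k j b ≈ paired j b
      between-≤ k {j} p b =
        reflexive (≡.cong (λ d → if d then paired j b else runner j b) (dec-true (j ℕ.+ k ≤? h) p))

      between-≰ : ∀ k {j} → ¬ (j ℕ.+ k ≤ h) → ∀ b → between k j b ≈ runner j b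
      between-≰ k {j} p b =
        reflexive (≡.cong (λ d → if d then paired j b else runner j b) (dec-false (j ℕ.+ k ≤? h) p))

      eliminate-between : ∀ k → k ≤ h → weighted (h′ ℕ.+ k) (between k) ≈ weighted h′ (between 0)
      eliminate-between zero _ = reflexive (≡.cong (λ m → weighted m (between 0)) (ℕ.+-identityʳ h′))
      eliminate-between (suc k) k<h = begin
        weighted (h′ ℕ.+ suc k) (between (suc k))
          ≡⟨ ≡.cong (λ m → weighted m (between (suc k))) (ℕ.+-suc h′ k) ⟩
        weighted (suc (h′ ℕ.+ k)) (between (suc k))
          ≈⟨ eliminate-child (h′ ℕ.+ k) (between (suc k)) (between k) i twice 1≤i i≤m
               (λ ε → descents-between s i ε s≡m+i 1≤i i≤m) at-i off-i ⟩
        weighted (h′ ℕ.+ k) (between k)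
          ≈⟨ eliminate-between k (ℕ.<⇒≤ k<h) ⟩
        weighted h′ (between 0) ∎
        where
        i = h ∸ k
        a = suc (h′ ℕ.+ k)
        i+k≡h : i ℕ.+ k ≡ h
        i+k≡h = ℕ.m∸n+n≡m (ℕ.<⇒≤ k<h)
        1≤i : 1 ≤ i
        1≤i = ℕ.m<n⇒0<n∸m k<h
        i≤m : i ≤ h′ ℕ.+ k
        i≤m = ℕ.≤-trans (ℕ.m∸n≤m h k) (ℕ.≤-trans h≤h′ (ℕ.m≤m+n h′ k))
        s≡m+i : s ≡ h′ ℕ.+ k ℕ.+ i
        s≡m+i = ≡.trans s≡ (≡.trans (≡.cong (h′ ℕ.+_) (≡.trans (≡.sym i+k≡h) (ℕ.+-comm i k)))
                  (≡.sym (ℕ.+-assoc h′ k i)))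
        t∸i≡a : t ∸ i ≡ a
        t∸i≡a = ≡.trans (≡.cong (λ n → suc n ∸ i) s≡m+i) (ℕ.m+n∸n≡m a i)
        at-i : ∀ b → between k i b ≈ message (between (suc k)) a (twice b) * between (suc k) i b
        at-i b = begin
          between k i b
            ≈⟨ between-≤ k (ℕ.≤-reflexive i+k≡h) b ⟩
          message runner (t ∸ i) (twice b) * runner i b
            ≡⟨ ≡.cong (λ a → message runner a (twice b) * runner i b) t∸i≡a ⟩
          message runner a (twice b) * runner i b
            ≈⟨ *-cong (message-cong (between (suc k)) runner a (twice b) (between-≰ (suc k) a≰))
                 (between-≰ (suc k) (ℕ.<⇒≱ (ℕ.≤-reflexive (≡.sym (≡.trans (ℕ.+-suc i k) (≡.cong suc i+k≡h))))) b) ⟨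
          message (between (suc k)) a (twice b) * between (suc k) i b ∎
          where
          a≰ : ¬ (a ℕ.+ suc k ≤ h)
          a≰ = ℕ.<⇒≱ (s≤s (ℕ.≤-trans h≤h′ (ℕ.≤-trans (ℕ.m≤m+n h′ k) (ℕ.m≤m+n (h′ ℕ.+ k) (suc k)))))
        off-i : ∀ j → 1 ≤ j → j ≤ h′ ℕ.+ k → j ≢ i → ∀ b → between k j b ≈ between (suc k) j b
        off-i j _ _ j≢i b with j ℕ.+ k ≤? h
        ... | no p  = trans (between-≰ k p b)
                (sym (between-≰ (suc k) (λ p′ → p (ℕ.≤-trans (ℕ.+-monoʳ-≤ j (ℕ.n≤1+n k)) p′)) b))
        ... | yes p = trans (between-≤ k p b) (sym (between-≤ (suc k)
                (≡.subst (_≤ h) (≡.sym (ℕ.+-suc j k))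
                  (ℕ.≤∧≢⇒< p λ e → j≢i (ℕ.+-cancelʳ-≡ k j i (≡.trans e (≡.sym i+k≡h))))) b))

      eliminate-outer : weighted s runner ≈ weighted h′ (between 0)
      eliminate-outer = begin
        weighted s runner
          ≡⟨ ≡.cong (λ m → weighted m runner) s≡ ⟩
        weighted (h′ ℕ.+ h) runner
          ≈⟨ weighted-cong (h′ ℕ.+ h) (λ j 1≤j _ b →
               sym (between-≰ h (ℕ.<⇒≱ (ℕ.+-monoˡ-≤ h 1≤j)) b)) ⟩
        weighted (h′ ℕ.+ h) (between h)
          ≈⟨ eliminate-between h ℕ.≤-refl ⟩
        weighted h′ (between 0) ∎

      eliminate-pairs : ∀ k → k ≤ h → weighted k (between 0) ≈ pairs k w
      eliminate-pairs zero    _   = trans (*-identityʳ _) (*-identityʳ 1#)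
      eliminate-pairs (suc k) k<h = trans
        (eliminate-root k (between 0) 0 (λ ε → descents-below s ε 2k<s))
        (*-cong (trans (message-cong (between 0) paired (suc k) 0 (between-≤ 0 (≡.subst (_≤ h) (≡.sym (ℕ.+-identityʳ _)) k<h))) (pair k))
          (eliminate-pairs k (ℕ.<⇒≤ k<h)))
        where
        2k<s : suc (k ℕ.+ k) < s
        2k<s = ≡.subst (suc (suc (k ℕ.+ k)) ≤_) (≡.sym s≡)
          (≡.subst (_≤ h′ ℕ.+ h) (≡.cong suc (ℕ.+-suc k k)) (ℕ.+-mono-≤ (ℕ.≤-trans k<h h≤h′) k<h))
        pair : ∀ k → message paired (suc k) 0 ≈ 𝒢 (u ^ suc k) (u ^ (t ∸ suc k)) w
        pair k = trans (+-cong (*-cong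
            (+-cong (𝒜-cong eb refl) (*-congˡ (ℬ-cong eb refl))) (𝒜-cong ea refl))
            (*-congˡ (*-cong (+-cong (𝒜-cong eb refl) (*-congˡ (ℬ-cong eb refl))) (ℬ-cong ea refl))))
          (solve 7 (λ a0 a1 b0 b1 a b x →
             (b0 :+ :1 :* b :* b1) :* a0 :+ :1 :* a :* ((b0 :+ x :* (x :* :1) :* b :* b1) :* a1)
             := a0 :* (b0 :+ b :* b1) :+ a :* (a1 :* (b0 :+ (:1 :- (:1 :- x :* x)) :* (b :* b1))))
             refl _ _ _ _ _ _ _)
          where
          ea = ^-homo-* u (suc k) t
          eb = ^-homo-* u (t ∸ suc k) t

    total-odd : ∀ h → s ≡ h ℕ.+ h → total (suc (s ℕ.+ N)) ≈ fixed x t w * pairs h w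
    total-odd h s≡ = trans total-above (trans eliminate-t (*-congˡ
      (trans (eliminate-outer h h s≡ ℕ.≤-refl) (eliminate-pairs h h s≡ ℕ.≤-refl h ℕ.≤-refl))))

    total-even : ∀ h → s ≡ suc h ℕ.+ h → total (suc (s ℕ.+ N)) ≈ fixed x t w * (fixed x (suc h) w * pairs h w)
    total-even h ≡.refl = trans total-above (trans eliminate-t (*-congˡ
      (trans (eliminate-outer h (suc h) ≡.refl (ℕ.n≤1+n h))
        (trans (eliminate-root h τ 1 descents-half)
          (*-cong
            (trans (message-cong τ runner (suc h) 1 (between-≰ h (suc h) ≡.refl (ℕ.n≤1+n h) 0
                (λ p → ℕ.<⇒≱ ℕ.≤-refl (≡.subst (_≤ h) (ℕ.+-identityʳ (suc h)) p))))
              (message-fixed (suc h)))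
            (eliminate-pairs h (suc h) ≡.refl (ℕ.n≤1+n h) h ℕ.≤-refl))))))
      where τ = between h (suc h) ≡.refl (ℕ.n≤1+n h) 0

  total-one : ∀ m → total 1# m ≈ poch (- u) u m
  total-one zero    = *-identityʳ 1#
  total-one (suc m) = begin
    ∑ m (λ ε → weight 1# (false ∷ ε)) + ∑ m (λ ε → weight 1# (true ∷ ε))
      ≈⟨ +-cong (∑-cong m (weight-false 1#)) (∑-cong m (λ ε → trans
           (*-cong (trans (one^ (descents s (path (true ∷ ε)))) (sym (one^ (descents s (path ε)))))
             (^-homo-* u (suc m) (sum (parts ε))))
           (solve 3 (λ a b c → a :* (b :* c) := b :* (a :* c)) refl _ _ _))) ⟩
    total 1# m + ∑ m (λ ε → u ^ suc m * weight 1# ε)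
      ≈⟨ +-congˡ (∑-*ˡ m (u ^ suc m) _) ⟩
    total 1# m + u * u ^ m * total 1# m
      ≈⟨ solve 3 (λ u v z → z :+ u :* v :* z := (:1 :- (:- u) :* v) :* z) refl _ _ _ ⟩
    (1# - (- u) * u ^ m) * total 1# m
      ≈⟨ *-congˡ (total-one m) ⟩
    poch (- u) u (suc m) ∎
    where
    one^ : ∀ n → 1# ^ n ≈ 1#
    one^ zero    = refl
    one^ (suc n) = trans (*-identityˡ _) (one^ n)

  private
    M : ℕ
    M = suc (s ℕ.+ N)

    w-one : 1# - 1# * 1# ≈ 0#
    w-one = solve 0 (:1 :- :1 :* :1 := con (ℤ.+ 0)) refl

    x²-w : ∀ x → x * x ≈ 1# - (1# - x * x)
    x²-w = solve 1 (λ x → x :* x := :1 :- (:1 :- x :* x)) refl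

    fixed-one′ : ∀ a → fixed 1# a (1# - 1# * 1#) ≈ 𝒜 (u ^ a) 0#
    fixed-one′ a = trans
      (+-cong (𝒜-cong refl w-one) (*-congˡ (*-congˡ (ℬ-cong refl w-one)))) (fixed-one a)

  -- The product (-u;u) is total 1#, the case x = 1 (w = 0).

  total-odd-𝒟 : ∀ h → s ≡ h ℕ.+ h → ∀ x e → (1# + x) * e ≈ 1# →
    let w = 1# - x * x in
    total x M ≈ poch (- u) u M * poch (Q * w) Q N ^ h * 𝒟 x e w
  total-odd-𝒟 h s≡ x e inv = begin
    total x M
      ≈⟨ total-odd x h s≡ ⟩
    fixed x t w * pairs h w
      ≈⟨ *-cong (fixed-𝒟 x e w inv (x²-w x)) (pairs-limit h h≤t w) ⟩
    𝒟 x e w * 𝒜 Q 0# * (P * pairs h 0#)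
      ≈⟨ solve 4 (λ d a p g → d :* a :* (p :* g) := a :* g :* p :* d) refl _ _ _ _ ⟩
    𝒜 Q 0# * pairs h 0# * P * 𝒟 x e w
      ≈⟨ *-congʳ (*-congʳ (*-cong (fixed-one′ t) (pairs-cong h w-one))) ⟨
    fixed 1# t (1# - 1# * 1#) * pairs h (1# - 1# * 1#) * P * 𝒟 x e w
      ≈⟨ *-congʳ (*-congʳ (trans (sym (total-odd 1# h s≡)) (total-one M))) ⟩
    poch (- u) u M * P * 𝒟 x e w ∎
    where
    w = 1# - x * x
    P = poch (Q * w) Q N ^ h
    h≤t : h ≤ t
    h≤t = ℕ.m≤n⇒m≤1+n (≡.subst (h ≤_) (≡.sym s≡) (ℕ.m≤m+n h h))

  total-even-𝒟ℋ : ∀ h → s ≡ suc h ℕ.+ h → ∀ x e e′ σ r →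
    let w = 1# - x * x in
    (1# + x) * e ≈ 1# → (1# + 1#) * x * e′ ≈ 1# → r * r ≈ w → r ≈ (1# + x) * σ →
    total x M ≈ poch (- u) u M * poch (Q * w) Q N ^ h * 𝒟 x e w * ℋ e′ σ r (u ^ suc h)
  total-even-𝒟ℋ h s≡ x e e′ σ r inv inv′ r² r≈ = begin
    total x M
      ≈⟨ total-even x h s≡ ⟩
    fixed x t w * (fixed x (suc h) w * pairs h w)
      ≈⟨ *-cong (fixed-𝒟 x e w inv (x²-w x)) (*-cong
           (fixed-ℋ h (≡.cong suc (≡.trans (ℕ.+-suc h h) (≡.sym s≡))) x e w e′ σ r inv inv′ (x²-w x) r² r≈)
           (pairs-limit h h≤t w)) ⟩
    𝒟 x e w * 𝒜 Q 0# * (H * 𝒜 p 0# * (P * pairs h 0#))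
      ≈⟨ solve 6 (λ d a k b p g → d :* a :* (k :* b :* (p :* g)) := a :* (b :* g) :* p :* d :* k)
           refl _ _ _ _ _ _ ⟩
    𝒜 Q 0# * (𝒜 p 0# * pairs h 0#) * P * 𝒟 x e w * H
      ≈⟨ *-congʳ (*-congʳ (*-congʳ (*-cong (fixed-one′ t) (*-cong (fixed-one′ (suc h)) (pairs-cong h w-one))))) ⟨
    fixed 1# t v * (fixed 1# (suc h) v * pairs h v) * P * 𝒟 x e w * H
      ≈⟨ *-congʳ (*-congʳ (*-congʳ (trans (sym (total-even 1# h s≡)) (total-one M)))) ⟩
    poch (- u) u M * P * 𝒟 x e w * H ∎
    where
    w = 1# - x * x
    v = 1# - 1# * 1#
    p = u ^ suc h
    P = poch (Q * w) Q N ^ h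
    H = ℋ e′ σ r p
    h≤t : h ≤ t
    h≤t = ℕ.m≤n⇒m≤1+n (≡.subst (h ≤_) (≡.sym s≡) (ℕ.m≤n+m h (suc h)))

module CauchyProduct {c ℓ} (R : CommutativeRing c ℓ) where
  open CommutativeRing R
  open PowerSeries R
  open IntegerSolver R

  ⊛-cong : ∀ n {f f′ g g′} → (∀ i → i ≤ n → f i ≈ f′ i) → (∀ i → i ≤ n → g i ≈ g′ i) →
           (f ⊛ g) n ≈ (f′ ⊛ g′) n
  ⊛-cong zero    f≈ g≈ = +-congʳ (*-cong (f≈ 0 z≤n) (g≈ 0 z≤n))
  ⊛-cong (suc n) f≈ g≈ = +-cong (*-cong (f≈ 0 z≤n) (g≈ (suc n) ℕ.≤-refl))
    (⊛-cong n (λ i i≤n → f≈ (suc i) (s≤s i≤n)) (λ i i≤n → g≈ i (ℕ.m≤n⇒m≤1+n i≤n)))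

  ⊛-distribʳ : ∀ h f g → (f ⊕ g) ⊛ h ≋ (f ⊛ h) ⊕ (g ⊛ h)
  ⊛-distribʳ h f g zero    = solve 3 (λ f g h → (f :+ g) :* h :+ :0 := (f :* h :+ :0) :+ (g :* h :+ :0)) refl _ _ _
  ⊛-distribʳ h f g (suc n) = trans (+-congˡ (⊛-distribʳ h (f ∘ suc) (g ∘ suc) n))
    (solve 5 (λ f g h a b → (f :+ g) :* h :+ (a :+ b) := (f :* h :+ a) :+ (g :* h :+ b)) refl _ _ _ _ _)

  ⊛-scale : ∀ a f g → (λ i → a * f i) ⊛ g ≋ (λ i → a * (f ⊛ g) i)
  ⊛-scale a f g zero    = solve 3 (λ a f g → a :* f :* g :+ :0 := a :* (f :* g :+ :0)) refl _ _ _
  ⊛-scale a f g (suc n) = trans (+-congˡ (⊛-scale a (f ∘ suc) g n))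
    (solve 4 (λ a f g b → a :* f :* g :+ a :* b := a :* (f :* g :+ b)) refl _ _ _ _)

  ⊛-assoc : ∀ f g h → (f ⊛ g) ⊛ h ≋ f ⊛ (g ⊛ h)
  ⊛-assoc f g h zero    = solve 3 (λ f g h → (f :* g :+ :0) :* h :+ :0 := f :* (g :* h :+ :0) :+ :0) refl _ _ _
  ⊛-assoc f g h (suc n) = trans
    (+-congˡ (trans (⊛-distribʳ h (λ i → f 0 * g (suc i)) ((f ∘ suc) ⊛ g) n)
      (+-cong (⊛-scale (f 0) (g ∘ suc) h n) (⊛-assoc (f ∘ suc) g h n))))
    (solve 5 (λ f g h a b → (f :* g :+ :0) :* h :+ (f :* a :+ b) := f :* (g :* h :+ a) :+ b) refl _ _ _ _ _)

  ⊛-last : ∀ f g n → (f ⊛ g) (suc n) ≈ f (suc n) * g 0 + (f ⊛ (g ∘ suc)) n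
  ⊛-last f g zero    = solve 4 (λ a b c d → a :* b :+ (c :* d :+ :0) := c :* d :+ (a :* b :+ :0)) refl _ _ _ _
  ⊛-last f g (suc n) = trans (+-congˡ (⊛-last (f ∘ suc) g n))
    (solve 3 (λ a b c → a :+ (b :+ c) := b :+ (a :+ c)) refl _ _ _)

  ⊛-comm : ∀ f g → f ⊛ g ≋ g ⊛ f
  ⊛-comm f g zero    = +-congʳ (*-comm _ _)
  ⊛-comm f g (suc n) = trans (+-cong (*-comm _ _) (⊛-comm (f ∘ suc) g n)) (sym (⊛-last g f n))

  zero-⊛ : ∀ g → (λ _ → 0#) ⊛ g ≋ (λ _ → 0#)
  zero-⊛ g zero    = trans (+-identityʳ _) (zeroˡ _)
  zero-⊛ g (suc n) = trans (+-cong (zeroˡ _) (zero-⊛ g n)) (+-identityˡ _)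

  const-⊛ : ∀ a f → const a ⊛ f ≋ (λ i → a * f i)
  const-⊛ a f zero    = +-identityʳ _
  const-⊛ a f (suc n) = trans (+-congˡ (zero-⊛ f n)) (+-identityʳ _)

  const-0 : ∀ n → const 0# n ≈ 0#
  const-0 zero    = refl
  const-0 (suc n) = refl

  q⊛-suc : ∀ f n → (q ⊛ f) (suc n) ≈ f n
  q⊛-suc f n = trans (+-cong (zeroˡ _)
    (trans (⊛-cong n {q ∘ suc} {const 1#} {f} {f} (λ { zero _ → refl ; (suc _) _ → refl }) (λ _ _ → refl))
      (trans (const-⊛ 1# f n) (*-identityˡ _)))) (+-identityˡ _)

  q↑-diagonal : ∀ k → (q ↑ k) k ≈ 1#
  q↑-diagonal zero    = refl
  q↑-diagonal (suc k) = trans (q⊛-suc (q ↑ k) k) (q↑-diagonal k)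

  q↑-off-diagonal : ∀ k n → n ≢ k → (q ↑ k) n ≈ 0#
  q↑-off-diagonal zero    zero    n≢k = ⊥-elim (n≢k ≡.refl)
  q↑-off-diagonal zero    (suc n) _   = refl
  q↑-off-diagonal (suc k) zero    _   = trans (+-identityʳ _) (zeroˡ _)
  q↑-off-diagonal (suc k) (suc n) n≢k =
    trans (q⊛-suc (q ↑ k) n) (q↑-off-diagonal k n (n≢k ∘ ≡.cong suc))

  record Agree (N : ℕ) (f g : Series) : Set ℓ where
    constructor agree
    field coefficient : ∀ i → i < N → f i ≈ g i
  open Agree public

  -- Opaque, because series are functions: comparing two products would unfold
  -- them into sums.
  infixl 7 _·_
  opaque
    _·_ : Series → Series → Series
    _·_ = _⊛_

    ·≡⊛ : ∀ f g → f · g ≡ f ⊛ g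
    ·≡⊛ f g = ≡.refl

    ·-cong : ∀ {N f f′ g g′} → Agree N f f′ → Agree N g g′ → Agree N (f · g) (f′ · g′)
    ·-cong {f = f} {f′} {g} {g′} (agree e) (agree e′) = agree λ i p → ⊛-cong i {f} {f′} {g} {g′}
      (λ j j≤i → e j (ℕ.≤-<-trans j≤i p)) (λ j j≤i → e′ j (ℕ.≤-<-trans j≤i p))

    ·-assoc : ∀ {N} f g h → Agree N (f · g · h) (f · (g · h))
    ·-assoc f g h = agree λ i _ → ⊛-assoc f g h i

    ·-comm : ∀ {N} f g → Agree N (f · g) (g · f)
    ·-comm f g = agree λ i _ → ⊛-comm f g i

    ·-distribʳ : ∀ {N} h f g → Agree N ((f ⊕ g) · h) (f · h ⊕ g · h)
    ·-distribʳ h f g = agree λ i _ → ⊛-distribʳ h f g i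

    const-· : ∀ a f n → (const a · f) n ≈ a * f n
    const-· = const-⊛

  const-cong : ∀ {N a b} → a ≈ b → Agree N (const a) (const b)
  const-cong a≈b = agree λ { zero _ → a≈b ; (suc _) _ → refl }

  const-+ : ∀ {N} a b → Agree N (const (a + b)) (const a ⊕ const b)
  const-+ a b = agree λ { zero _ → refl ; (suc _) _ → sym (+-identityˡ 0#) }

  const-* : ∀ {N} a b → Agree N (const (a * b)) (const a · const b)
  const-* a b = agree λ
    { zero    _ → sym (const-· a (const b) 0)
    ; (suc n) _ → sym (trans (const-· a (const b) (suc n)) (zeroʳ a)) }

  const-neg : ∀ {N} a → Agree N (const (- a)) (⊖ const a)
  const-neg a = agree λ { zero _ → refl ; (suc _) _ → sym (-0≈0 refl) }

  -- R⟦q⟧ / (q^N)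
  truncated : ℕ → CommutativeRing c ℓ
  truncated N = record
    { Carrier = Series
    ; _≈_ = Agree N
    ; _+_ = _⊕_ ; _*_ = _·_ ; -_ = ⊖_ ; 0# = const 0# ; 1# = const 1#
    ; isCommutativeRing = record
      { isRing = record
        { +-isAbelianGroup = record
          { isGroup = record
            { isMonoid = record
              { isSemigroup = record
                { isMagma = record
                  { isEquivalence = record
                    { refl  = agree λ _ _ → refl
                    ; sym   = λ (agree e) → agree λ i p → sym (e i p)
                    ; trans = Agree-trans }
                  ; ∙-cong = λ (agree e) (agree e′) → agree λ i p → +-cong (e i p) (e′ i p) }
                ; assoc = λ f g h → agree λ i _ → +-assoc (f i) (g i) (h i) }
              ; identity = (λ f → agree λ i _ → trans (+-congʳ (const-0 i)) (+-identityˡ (f i)))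
                         , (λ f → agree λ i _ → trans (+-congˡ (const-0 i)) (+-identityʳ (f i))) }
            ; inverse = (λ f → agree λ i _ → trans (-‿inverseˡ (f i)) (sym (const-0 i)))
                      , (λ f → agree λ i _ → trans (-‿inverseʳ (f i)) (sym (const-0 i)))
            ; ⁻¹-cong = λ (agree e) → agree λ i p → -‿cong (e i p) }
          ; comm = λ f g → agree λ i _ → +-comm (f i) (g i) }
        ; *-cong = ·-cong
        ; *-assoc = ·-assoc
        ; *-identity = 1· , (λ f → Agree-trans (·-comm f (const 1#)) (1· f))
        ; distrib = (λ h f g → Agree-trans (·-comm h (f ⊕ g)) (Agree-trans (·-distribʳ h f g)
                      (agree λ i p → +-cong (coefficient (·-comm f h) i p) (coefficient (·-comm g h) i p))))
                  , ·-distribʳ }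
      ; *-comm = ·-comm } }
    where
    Agree-trans : ∀ {f g h} → Agree N f g → Agree N g h → Agree N f h
    Agree-trans (agree e) (agree e′) = agree λ i p → trans (e i p) (e′ i p)
    1· : ∀ f → Agree N (const 1# · f) f
    1· f = agree λ i _ → trans (const-· 1# f i) (*-identityˡ (f i))

module Coefficients {c ℓ} (R : CommutativeRing c ℓ) (s n : ℕ) (x : CommutativeRing.Carrier R) where
  open CommutativeRing R
  open PowerSeries R
  open CauchyProduct R
  open IntegerSolver R
  open BitSums R using (∑; ∑-cong)
  private
    module S = CommutativeRing (truncated (suc n))
    module P = Pochhammer (truncated (suc n))
    module E = Elimination (truncated (suc n)) s (const x) (q ↑ 2)
    module BS = BitSums (truncated (suc n))

  ↑≡^ : ∀ f k → f ↑ k ≡ f P.^ k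
  ↑≡^ f zero    = ≡.refl
  ↑≡^ f (suc k) = ≡.trans (≡.cong (f ⊛_) (↑≡^ f k)) (≡.sym (·≡⊛ f (f P.^ k)))

  ↑-power : ∀ f j k → (f ↑ j) P.^ k S.≈ f ↑ (j ℕ.* k)
  ↑-power f j k rewrite ↑≡^ f j | ↑≡^ f (j ℕ.* k) = P.^-assocʳ f j k

  const-^ : ∀ k → const x P.^ k S.≈ const (x ^ k)
  const-^ zero    = S.refl
  const-^ (suc k) = S.trans (S.*-congˡ (const-^ k)) (S.sym (const-* x (x ^ k)))

  term : List ℕ → Carrier
  term ν = if does (sum (doubled ν) ≟ n) then x ^ hookCount (suc s) (doubled ν) else 0#

  ∑ₗ : List Carrier → Carrier
  ∑ₗ = foldr _+_ 0#

  ∑ₗ-++ : ∀ xs ys → ∑ₗ (xs ++ ys) ≈ ∑ₗ xs + ∑ₗ ys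
  ∑ₗ-++ []       ys = sym (+-identityˡ _)
  ∑ₗ-++ (x ∷ xs) ys = trans (+-congˡ (∑ₗ-++ xs ys)) (sym (+-assoc _ _ _))

  ∑-filter : ∀ νs →
    ∑ₗ (map (λ μ → x ^ hookCount (suc s) μ) (filter (λ μ → sum μ ≟ n) (map doubled νs))) ≈ ∑ₗ (map term νs)
  ∑-filter []       = refl
  ∑-filter (ν ∷ νs) with does (sum (doubled ν) ≟ n)
  ... | true  = +-congˡ (∑-filter νs)
  ... | false = trans (∑-filter νs) (sym (+-identityˡ _))

  ∑-strict : ∀ m (φ : List ℕ → Carrier) → ∑ₗ (map φ (strictPartitions≤ m)) ≈ ∑ m (φ ∘ parts)
  ∑-strict zero    φ = +-identityʳ _
  ∑-strict (suc m) φ = begin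
    ∑ₗ (map φ (νs ++ map (suc m ∷_) νs))
      ≡⟨ ≡.cong ∑ₗ (map-++ φ νs _) ⟩
    ∑ₗ (map φ νs ++ map φ (map (suc m ∷_) νs))
      ≈⟨ ∑ₗ-++ (map φ νs) _ ⟩
    ∑ₗ (map φ νs) + ∑ₗ (map φ (map (suc m ∷_) νs))
      ≡⟨ ≡.cong (λ xs → ∑ₗ (map φ νs) + ∑ₗ xs) (≡.sym (map-∘ νs)) ⟩
    ∑ₗ (map φ νs) + ∑ₗ (map (φ ∘ (suc m ∷_)) νs)
      ≈⟨ +-cong (∑-strict m φ) (∑-strict m (φ ∘ (suc m ∷_))) ⟩
    ∑ (suc m) (φ ∘ parts) ∎
    where
    open import Relation.Binary.Reasoning.Setoid setoid
    νs = strictPartitions≤ m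

  term-large : ∀ {m} (ε : Vec Bool m) → n ≤ m → term (suc m ∷ parts ε) ≈ 0#
  term-large {m} ε n≤m = reflexive (≡.cong
    (λ d → if d then x ^ hookCount (suc s) (doubled (suc m ∷ parts ε)) else 0#)
    (dec-false (sum (doubled (suc m ∷ parts ε)) ≟ n) λ e →
      ℕ.<⇒≱ (s≤s n≤m) (ℕ.≤-trans (ℕ.m≤m+n (suc m) (sum (parts ε)))
        (ℕ.≤-trans (ℕ.m≤m+n _ _) (ℕ.≤-reflexive (≡.trans (≡.sym (size-doubled (true ∷ ε))) e))))))

  ∑-extend : ∀ d → ∑ (d ℕ.+ n) (term ∘ parts) ≈ ∑ n (term ∘ parts)
  ∑-extend zero    = refl
  ∑-extend (suc d) = trans
    (+-cong (∑-extend d) (trans (∑-cong (d ℕ.+ n) (λ ε → term-large ε (ℕ.m≤n+m n d))) (∑-zero (d ℕ.+ n))))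
    (+-identityʳ _)
    where
    ∑-zero : ∀ m → ∑ m (λ _ → 0#) ≈ 0#
    ∑-zero zero    = refl
    ∑-zero (suc m) = trans (+-cong (∑-zero m) (∑-zero m)) (+-identityʳ _)

  ∑-coefficient : ∀ m φ → BS.∑ m φ n ≡ ∑ m (λ ε → φ ε n)
  ∑-coefficient zero    φ = ≡.refl
  ∑-coefficient (suc m) φ = ≡.cong₂ _+_ (∑-coefficient m _) (∑-coefficient m _)

  q↑-coefficient : ∀ k a → a * (q ↑ k) n ≈ (if does (k ≟ n) then a else 0#)
  q↑-coefficient k a with k ≟ n
  ... | yes ≡.refl = trans (trans (*-congˡ (q↑-diagonal k)) (*-identityʳ a))
        (reflexive (≡.cong (λ d → if d then a else 0#) (≡.sym (dec-true (k ≟ k) ≡.refl))))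
  ... | no k≢n     = trans (trans (*-congˡ (q↑-off-diagonal k n (k≢n ∘ ≡.sym))) (zeroʳ a))
        (reflexive (≡.cong (λ d → if d then a else 0#) (≡.sym (dec-false (k ≟ n) k≢n))))

  weight-coefficient : ∀ {m} (ε : Vec Bool m) → E.weight ε n ≈ term (parts ε)
  weight-coefficient ε = begin
    E.weight ε n
      ≈⟨ coefficient (S.*-cong (const-^ d) (↑-power q 2 k)) n ℕ.≤-refl ⟩
    (const (x ^ d) · q ↑ (2 ℕ.* k)) n
      ≈⟨ const-· (x ^ d) (q ↑ (2 ℕ.* k)) n ⟩
    x ^ d * (q ↑ (2 ℕ.* k)) n
      ≈⟨ q↑-coefficient (2 ℕ.* k) (x ^ d) ⟩
    (if does (2 ℕ.* k ≟ n) then x ^ d else 0#)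
      ≡⟨ ≡.cong₂ (λ k d → if does (k ≟ n) then x ^ d else 0#)
           (≡.sym (size-doubled ε)) (≡.sym (hookCount-doubled s ε)) ⟩
    term (parts ε) ∎
    where
    open import Relation.Binary.Reasoning.Setoid setoid
    d = descents s (path ε)
    k = sum (parts ε)

  F-coefficient : ∀ d → F (suc s) x n ≈ BS.∑ (d ℕ.+ n) E.weight n
  F-coefficient d = begin
    F (suc s) x n
      ≈⟨ ∑-filter (strictPartitions≤ n) ⟩
    ∑ₗ (map term (strictPartitions≤ n))
      ≈⟨ ∑-strict n term ⟩
    ∑ n (term ∘ parts)
      ≈⟨ ∑-extend d ⟨
    ∑ (d ℕ.+ n) (term ∘ parts)
      ≈⟨ ∑-cong (d ℕ.+ n) weight-coefficient ⟨
    ∑ (d ℕ.+ n) (λ ε → E.weight ε n)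
      ≡⟨ ∑-coefficient (d ℕ.+ n) E.weight ⟨
    BS.∑ (d ℕ.+ n) E.weight n ∎
    where open import Relation.Binary.Reasoning.Setoid setoid

module TruncatedIdentity {c ℓ} (R : CommutativeRing c ℓ) (t s : ℕ) (t≡ : t ≡ suc s) (n : ℕ)
         (x e : CommutativeRing.Carrier R) where
  open CommutativeRing R
  open PowerSeries R
  open CauchyProduct R
  open IntegerSolver R
  private
    N : ℕ
    N = suc n
    module S = CommutativeRing (truncated N)
    module P = Pochhammer (truncated N)
    module C = Coefficients R s n x

    ↑-zero : ∀ f k → f 0 ≈ 0# → (f ↑ suc k) 0 ≈ 0#
    ↑-zero f k f₀ = ↑-vanish f f₀ (suc k) 0 (s≤s z≤n)

    ↑-Agree : ∀ f k → f ↑ k S.≈ f P.^ k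
    ↑-Agree f k = S.reflexive (C.↑≡^ f k)

    qᵗ-zero : (q ↑ t) 0 ≈ 0#
    qᵗ-zero = ≡.subst (λ t → (q ↑ t) 0 ≈ 0#) (≡.sym t≡) (↑-zero q s refl)

    uᴺ≈0 : (q ↑ 2) P.^ N S.≈ const 0#
    uᴺ≈0 = S.trans (S.sym (↑-Agree (q ↑ 2) N)) (agree λ i i<N →
      trans (↑-vanish (q ↑ 2) (↑-zero q 1 refl) N i i<N) (sym (const-0 i)))

    open module RP = RunnerProduct (truncated N) s N (q ↑ 2) uᴺ≈0 using (Q)

    finitePochhammer≡poch : ∀ A B k → finitePochhammer A B k ≡ P.poch A B k
    finitePochhammer≡poch A B zero    = ≡.refl
    finitePochhammer≡poch A B (suc k) =
      ≡.trans (≡.cong₂ (λ b p → (const 1# ⊕ ⊖ (A ⊛ b)) ⊛ p) (C.↑≡^ B k) (finitePochhammer≡poch A B k))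
      (≡.trans (≡.cong (λ a → (const 1# ⊕ ⊖ a) ⊛ P.poch A B k) (≡.sym (·≡⊛ A (B P.^ k))))
        (≡.sym (·≡⊛ _ (P.poch A B k))))

    ⊛-Agree : ∀ f g {f′ g′} → f S.≈ f′ → g S.≈ g′ → f ⊛ g S.≈ f′ S.* g′
    ⊛-Agree f g f≈ g≈ = S.trans (S.reflexive (≡.sym (·≡⊛ f g))) (S.*-cong f≈ g≈)

    pochhammer : ∀ {A B A′ B′} K → N ≤ K → B 0 ≈ 0# → A S.≈ A′ → B S.≈ B′ →
                 ⟦ A ⨾ B ⟧∞ S.≈ P.poch A′ B′ K
    pochhammer {A} {B} K N≤K B₀ A≈ B≈ = S.trans
      (S.sym (S.trans (S.sym (S.reflexive (finitePochhammer≡poch A B K))) (agree λ i i<N → trans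
        (reflexive (≡.cong (λ k → finitePochhammer A B k i) (≡.sym (ℕ.m∸n+n≡m (ℕ.≤-trans i<N N≤K)))))
        (pochhammer-limit A B B₀ i (K ∸ suc i)))))
      (P.poch-cong K A≈ B≈)

    X w : Series
    X = const x
    w = const 1# S.- X S.* X

    const-1- : ∀ a → const (1# - a) S.≈ const 1# S.- const a
    const-1- a = S.trans (const-+ 1# (- a)) (S.+-congˡ (const-neg a))

    w≈ : const (1# - x ^ 2) S.≈ w
    w≈ = S.trans (const-1- (x ^ 2)) (S.+-congˡ (S.-‿cong
      (S.trans (const-cong (*-congˡ (*-identityʳ x))) (const-* x x))))

    Qᵗ : (q ↑ 2) P.^ t S.≈ Q
    Qᵗ = P.^-congʳ (q ↑ 2) t≡

    u^ : ∀ k → q ↑ (2 ℕ.* k) S.≈ (q ↑ 2) P.^ k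
    u^ k = S.sym (C.↑-power q 2 k)

    q²ᵗ : q ↑ (2 ℕ.* t) S.≈ Q
    q²ᵗ = S.trans (u^ t) Qᵗ

    qᵗ↑ : ∀ k → (q ↑ t) ↑ k S.≈ q ↑ (t ℕ.* k)
    qᵗ↑ k = S.trans (↑-Agree (q ↑ t) k) (C.↑-power q t k)

    q↑-cong : ∀ {j k} → j ≡ k → q ↑ j S.≈ q ↑ k
    q↑-cong j≡k = S.reflexive (≡.cong (q ↑_) j≡k)

    qᵗ² : (q ↑ t) ↑ 2 S.≈ Q
    qᵗ² = S.trans (qᵗ↑ 2) (S.trans (q↑-cong (ℕ.*-comm t 2)) q²ᵗ)

    qᵗ⁴ : (q ↑ t) ↑ 4 S.≈ Q S.* Q
    qᵗ⁴ = S.trans (qᵗ↑ 4) (S.trans (q↑-cong (double t))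
      (S.trans (u^ (t ℕ.+ t)) (S.trans (P.^-homo-* (q ↑ 2) t t) (S.*-cong Qᵗ Qᵗ))))
      where
      double : ∀ t → t ℕ.* 4 ≡ 2 ℕ.* (t ℕ.+ t)
      double = ℕ-Solver.solve-∀

    distinct : ⟦ ⊖ (q ↑ 2) ⨾ q ↑ 2 ⟧∞ S.≈ P.poch (S.- (q ↑ 2)) (q ↑ 2) (suc (s ℕ.+ N))
    distinct = pochhammer (suc (s ℕ.+ N)) (ℕ.m≤n⇒m≤1+n (ℕ.m≤n+m N s)) (↑-zero q 1 refl) S.refl S.refl

    pair-factor : ∀ h → ⟦ const (1# - x ^ 2) ⊛ q ↑ (2 ℕ.* t) ⨾ q ↑ (2 ℕ.* t) ⟧∞ ↑ h
                        S.≈ P.poch (Q S.* w) Q N P.^ h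
    pair-factor h = S.trans
      (↑-Agree ⟦ const (1# - x ^ 2) ⊛ q ↑ (2 ℕ.* t) ⨾ q ↑ (2 ℕ.* t) ⟧∞ h)
      (P.^-congˡ h (pochhammer N ℕ.≤-refl zero₂
        (S.trans (⊛-Agree (const (1# - x ^ 2)) (q ↑ (2 ℕ.* t)) w≈ q²ᵗ) (S.*-comm w Q)) q²ᵗ))
      where
      zero₂ : (q ↑ (2 ℕ.* t)) 0 ≈ 0#
      zero₂ = ≡.subst (λ t → (q ↑ (2 ℕ.* t)) 0 ≈ 0#) (≡.sym t≡) (↑-zero q (s ℕ.+ 1 ℕ.* suc s) refl)

    D*-𝒟 : D* x e (q ↑ t) S.≈ RP.𝒟 X (const e) w
    D*-𝒟 = ⊛-Agree (const e)
      (⟦ const (1# - x ^ 2) ⊛ (q ↑ t) ↑ 2 ⨾ (q ↑ t) ↑ 4 ⟧∞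
        ⊕ X ⊛ ⟦ const (1# - x ^ 2) ⊛ (q ↑ t) ↑ 4 ⨾ (q ↑ t) ↑ 4 ⟧∞)
      S.refl (S.+-cong
        (pochhammer N ℕ.≤-refl zero₄
          (S.trans (⊛-Agree (const (1# - x ^ 2)) ((q ↑ t) ↑ 2) w≈ qᵗ²) (S.*-comm w Q)) qᵗ⁴)
        (⊛-Agree X ⟦ const (1# - x ^ 2) ⊛ (q ↑ t) ↑ 4 ⨾ (q ↑ t) ↑ 4 ⟧∞ S.refl (pochhammer N ℕ.≤-refl zero₄
          (S.trans (⊛-Agree (const (1# - x ^ 2)) ((q ↑ t) ↑ 4) w≈ qᵗ⁴)
            (S.trans (S.sym (S.*-assoc w Q Q)) (S.*-comm (w S.* Q) Q))) qᵗ⁴)))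
      where
      zero₄ : ((q ↑ t) ↑ 4) 0 ≈ 0#
      zero₄ = ↑-zero (q ↑ t) 3 qᵗ-zero

    H*-ℋ : ∀ h → s ≡ suc h ℕ.+ h → ∀ e′ σ r →
           H* e′ σ r (q ↑ t) S.≈ RP.ℋ (const e′) (const σ) (const r) ((q ↑ 2) P.^ suc h)
    H*-ℋ h s≡ e′ σ r = ⊛-Agree (const e′)
      (const (1# - σ) ⊛ ⟦ const (- r) ⨾ ⊖ q ↑ t ⟧∞ ⊕ const (1# + σ) ⊛ ⟦ const r ⨾ ⊖ q ↑ t ⟧∞)
      S.refl (S.+-cong
        (⊛-Agree (const (1# - σ)) ⟦ const (- r) ⨾ ⊖ q ↑ t ⟧∞ (const-1- σ)
          (pochhammer N ℕ.≤-refl zero₁ (const-neg r) -qᵗ))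
        (⊛-Agree (const (1# + σ)) ⟦ const r ⨾ ⊖ q ↑ t ⟧∞ (const-+ 1# σ)
          (pochhammer N ℕ.≤-refl zero₁ S.refl -qᵗ)))
      where
      double : ∀ h → suc (suc h ℕ.+ h) ≡ 2 ℕ.* suc h
      double = ℕ-Solver.solve-∀
      -qᵗ : ⊖ q ↑ t S.≈ S.- ((q ↑ 2) P.^ suc h)
      -qᵗ = S.-‿cong (S.trans (q↑-cong (≡.trans t≡ (≡.trans (≡.cong suc s≡) (double h)))) (u^ (suc h)))
      zero₁ : - (q ↑ t) 0 ≈ 0#
      zero₁ = -0≈0 qᵗ-zero

    F-total : F t x n ≈ RP.total X (suc (s ℕ.+ N)) n
    F-total = trans (reflexive (≡.cong (λ t → F t x n) t≡)) (trans (C.F-coefficient (suc (suc s)))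
      (reflexive (≡.cong (λ m → RP.total X m n) (≡.cong suc (≡.sym (ℕ.+-suc s n))))))

    const-1+ : ∀ a b → const ((1# + a) * b) S.≈ (S.1# S.+ const a) S.* const b
    const-1+ a b = S.trans (const-* (1# + a) b) (S.*-congʳ (const-+ 1# a))

    product₃ : ∀ {y E E′ G G′ D D′} → E S.≈ E′ → G S.≈ G′ → D S.≈ D′ →
               y S.≈ E′ S.* G′ S.* D′ → y n ≈ (E ⊛ G ⊛ D) n
    product₃ {_} {E} {_} {G} {_} {D} E≈ G≈ D≈ y≈ = coefficient (S.trans y≈
      (S.sym (⊛-Agree (E ⊛ G) D (⊛-Agree E G E≈ G≈) D≈))) n ℕ.≤-refl

    product₄ : ∀ {y E E′ G G′ D D′ H H′} → E S.≈ E′ → G S.≈ G′ → D S.≈ D′ → H S.≈ H′ →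
               y S.≈ E′ S.* G′ S.* D′ S.* H′ → y n ≈ (E ⊛ G ⊛ D ⊛ H) n
    product₄ {_} {E} {_} {G} {_} {D} {_} {H} E≈ G≈ D≈ H≈ y≈ = coefficient (S.trans y≈
      (S.sym (⊛-Agree (E ⊛ G ⊛ D) H (⊛-Agree (E ⊛ G) D (⊛-Agree E G E≈ G≈) D≈) H≈))) n ℕ.≤-refl

  module _ (inv : (1# + x) * e ≈ 1#) where
    private
      inverse : (S.1# S.+ X) S.* const e S.≈ S.1#
      inverse = S.trans (S.sym (const-1+ x e)) (const-cong inv)

    F-odd : ∀ h → s ≡ h ℕ.+ h →
      F t x n ≈ (⟦ ⊖ (q ↑ 2) ⨾ q ↑ 2 ⟧∞
                ⊛ ⟦ const (1# - x ^ 2) ⊛ q ↑ (2 ℕ.* t) ⨾ q ↑ (2 ℕ.* t) ⟧∞ ↑ h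
                ⊛ D* x e (q ↑ t)) n
    F-odd h s≡ = trans F-total (product₃
      distinct (pair-factor h) D*-𝒟 (RP.total-odd-𝒟 h s≡ X (const e) inverse))

    F-even : ∀ h → s ≡ suc h ℕ.+ h → ∀ e′ σ r →
      ((1# + 1#) * x) * e′ ≈ 1# → r ^ 2 ≈ 1# - x ^ 2 → r ≈ (1# + x) * σ →
      F t x n ≈ (⟦ ⊖ (q ↑ 2) ⨾ q ↑ 2 ⟧∞
                ⊛ ⟦ const (1# - x ^ 2) ⊛ q ↑ (2 ℕ.* t) ⨾ q ↑ (2 ℕ.* t) ⟧∞ ↑ h
                ⊛ D* x e (q ↑ t)
                ⊛ H* e′ σ r (q ↑ t)) n
    F-even h s≡ e′ σ r inv′ r² r≈ = trans F-total (product₄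
      distinct (pair-factor h) D*-𝒟 (H*-ℋ h s≡ e′ σ r)
      (RP.total-even-𝒟ℋ h s≡ X (const e) (const e′) (const σ) (const r) inverse inverse′
        (S.trans (S.sym (const-* r r))
          (S.trans (const-cong (trans (*-congˡ (sym (*-identityʳ r))) r²)) w≈))
        (S.trans (const-cong r≈) (const-1+ x σ))))
      where
      inverse′ : (S.1# S.+ S.1#) S.* X S.* const e′ S.≈ S.1#
      inverse′ = S.trans (S.*-congʳ (S.sym (const-1+ 1# x)))
        (S.trans (S.sym (const-* ((1# + 1#) * x) e′)) (const-cong inv′))

parity : ∀ s → (∃ λ h → s ≡ h ℕ.+ h) ⊎ (∃ λ h → s ≡ suc h ℕ.+ h)
parity zero    = inj₁ (0 , ≡.refl)
parity (suc s) with parity s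
... | inj₁ (h , e) = inj₂ (h , ≡.cong suc e)
... | inj₂ (h , e) = inj₁ (suc h , ≡.cong suc (≡.trans e (≡.sym (ℕ.+-suc h h))))

double : ∀ h → h ℕ.+ h ≡ h ℕ.* 2
double = ℕ-Solver.solve-∀

half : ∀ h → (h ℕ.+ h) / 2 ≡ h
half h = ≡.trans (≡.cong (_/ 2) (double h)) (m*n/n≡m h 2)

2∤odd : ∀ h → ¬ (2 ∣ suc (h ℕ.+ h))
2∤odd h 2∣ with ∣1⇒≡1 (∣m+n∣m⇒∣n (≡.subst (2 ∣_) (ℕ.+-comm 1 (h ℕ.+ h)) 2∣) (divides h (double h)))
... | ()

half-odd : ∀ {t s} → t ≡ suc s → ¬ (2 ∣ t) → s ≡ (t ∸ 1) / 2 ℕ.+ (t ∸ 1) / 2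
half-odd {s = s} ≡.refl 2∤t with parity s
... | inj₁ (h , ≡.refl) = ≡.sym (≡.cong₂ ℕ._+_ (half h) (half h))
... | inj₂ (h , ≡.refl) =
  ⊥-elim (2∤t (divides (suc h) (≡.trans (≡.cong suc (≡.sym (ℕ.+-suc h h))) (double (suc h)))))

half-even : ∀ {t s} → t ≡ suc s → 2 ∣ t → s ≡ suc ((t ∸ 2) / 2) ℕ.+ (t ∸ 2) / 2
half-even {s = s} ≡.refl 2∣t with parity s
... | inj₁ (h , ≡.refl) = ⊥-elim (2∤odd h 2∣t)
... | inj₂ (h , ≡.refl) = ≡.cong suc (≡.sym (≡.cong₂ ℕ._+_ (half h) (half h)))

theorem1p1 : ∀ {c ℓ} (R : CommutativeRing c ℓ) →
    let open CommutativeRing R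
        open PowerSeries R
    in
    (x [1+x]⁻¹ : Carrier) → (1# + x) * [1+x]⁻¹ ≈ 1# →
    (t : ℕ) .{{_ : NonZero t}} →
    ( ¬ (2 ∣ t) →
      F t x ≋ ⟦ ⊖ (q ↑ 2) ⨾ q ↑ 2 ⟧∞
              ⊛ ⟦ const (1# - x ^ 2) ⊛ q ↑ (2 ℕ.* t) ⨾ q ↑ (2 ℕ.* t) ⟧∞ ↑ ((t ∸ 1) / 2)
              ⊛ D* x [1+x]⁻¹ (q ↑ t) )
    ×
    ( 2 ∣ t →
      ([2x]⁻¹ s r : Carrier) →
      ((1# + 1#) * x) * [2x]⁻¹ ≈ 1# →
      s ^ 2 ≈ (1# - x) * [1+x]⁻¹ →
      r ^ 2 ≈ 1# - x ^ 2 →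
      r ≈ (1# + x) * s →
      F t x ≋ ⟦ ⊖ (q ↑ 2) ⨾ q ↑ 2 ⟧∞
              ⊛ ⟦ const (1# - x ^ 2) ⊛ q ↑ (2 ℕ.* t) ⨾ q ↑ (2 ℕ.* t) ⟧∞ ↑ ((t ∸ 2) / 2)
              ⊛ D* x [1+x]⁻¹ (q ↑ t)
              ⊛ H* [2x]⁻¹ s r (q ↑ t) )
theorem1p1 R x e inv t =
  (λ 2∤t n → TruncatedIdentity.F-odd R t (ℕ.pred t) t≡ n x e inv ((t ∸ 1) / 2) (half-odd t≡ 2∤t)) ,
  (λ 2∣t e′ σ r inv′ _ r² r≈ n →
    TruncatedIdentity.F-even R t (ℕ.pred t) t≡ n x e inv ((t ∸ 2) / 2) (half-even t≡ 2∣t) e′ σ r inv′ r² r≈)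
  where
  t≡ : t ≡ suc (ℕ.pred t)
  t≡ = ≡.sym (ℕ.suc-pred t)
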